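{- Let $n$ be a positive integer, let $H_n$ be a $2$-connected maximal outerplanar graph with $n$ vertices and diameter $3$, and let $G_n$ be a $2$-connected outerplanar graph with $n$ vertices and diameter $3$. Then $\Delta(G_n)\le \chi'_{st}(G_n)\le \Delta(G_n)+6$. Moreover, if $G_n$ is a $2$-connected maximal outerplanar graph with $n$ vertices and diameter $3$, then $\Delta(G_n)\le \chi'_{st}(G_n)\le \Delta(G_n)+4$.
   Context: All graphs are finite, simple and undirected; $\Delta(G)$ is the maximum degree. An outerplanar graph is a graph that can be drawn in the plane without edge crossings with all vertices on the outer face; it is maximal outerplanar if adding any edge between nonadjacent vertices destroys outerplanarity. The diameter is the maximum distance between two vertices. A star edge coloring is a proper edge coloring with no path or cycle of length four (four edges) colored with only two colors; $\chi'_{st}(G)$ is the minimum number of colors in a star edge coloring of $G$. -}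

module Defs where

open import Data.Nat using (ℕ; zero; suc; _≤_; _<_; _⊔_; _+_)
open import Data.Fin using (Fin; _≟_) renaming (_<_ to _<ᶠ_)
open import Data.Bool using (Bool; true; false; T; _∨_; _∧_)
open import Data.List using (List; []; _∷_; length; filterᵇ; allFin; map; foldr)
open import Data.List.Relation.Unary.Unique.Propositional using (Unique)
open import Data.Product using (Σ; ∃; _×_; _,_)
open import Data.Sum using (_⊎_)
open import Data.Unit using (⊤)
open import Relation.Nullary using (¬_)
open import Relation.Nullary.Decidable using (⌊_⌋)
open import Relation.Binary.PropositionalEquality using (_≡_; _≢_)

record Graph (n : ℕ) : Set where
  field
    adj    : Fin n → Fin n → Bool
    sym    : ∀ u v → adj u v ≡ adj v u
    irrefl : ∀ v → adj v v ≡ false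

open Graph public

Adj : ∀ {n} → Graph n → Fin n → Fin n → Set
Adj G u v = T (adj G u v)

deg : ∀ {n} → Graph n → Fin n → ℕ
deg {n} G v = length (filterᵇ (adj G v) (allFin n))

Δ : ∀ {n} → Graph n → ℕ
Δ {n} G = foldr _⊔_ 0 (map (deg G) (allFin n))

data WalkIn {n} (G : Graph n) (P : Fin n → Set) : Fin n → Fin n → ℕ → Set where
  here : ∀ {u} → WalkIn G P u u 0
  step : ∀ {u v w k} → Adj G u v → P v → WalkIn G P v w k → WalkIn G P u w (suc k)

Any : ∀ {n} → Fin n → Set
Any _ = ⊤

Walk : ∀ {n} → Graph n → Fin n → Fin n → ℕ → Set
Walk G = WalkIn G Any

Distance : ∀ {n} → Graph n → Fin n → Fin n → ℕ → Set
Distance G u v d = Walk G u v d × (∀ k → Walk G u v k → d ≤ k)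

Diameter : ∀ {n} → Graph n → ℕ → Set
Diameter {n} G d =
  (∀ (u v : Fin n) → ∃ λ e → Distance G u v e × e ≤ d) ×
  (∃ λ (u : Fin n) → ∃ λ (v : Fin n) → Distance G u v d)

Connected : ∀ {n} → Graph n → Set
Connected {n} G = ∀ (u v : Fin n) → ∃ λ k → Walk G u v k

ConnectedWithout : ∀ {n} → Graph n → Fin n → Set
ConnectedWithout {n} G x =
  ∀ (u v : Fin n) → u ≢ x → v ≢ x → ∃ λ k → WalkIn G (λ y → y ≢ x) u v k

TwoConnected : ∀ {n} → Graph n → Set
TwoConnected {n} G = 2 < n × Connected G × (∀ x → ConnectedWithout G x)

-- Outerplanarity (combinatorial rendering of a drawing with all vertices
-- on the outer face: vertices placed on a circle in the cyclic order
-- given by the injective position map pos, edges drawn as chords,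
-- and no two edges cross, i.e. no interleaving pos a < pos c < pos b < pos d
-- for edges ab and cd).

OuterplanarAdj : ∀ {n} → (Fin n → Fin n → Bool) → Set
OuterplanarAdj {n} a =
  Σ (Fin n → Fin n) λ pos →
    (∀ x y → pos x ≡ pos y → x ≡ y) ×
    (∀ p q r s → T (a p q) → T (a r s) →
       ¬ (pos p <ᶠ pos r × pos r <ᶠ pos q × pos q <ᶠ pos s))

Outerplanar : ∀ {n} → Graph n → Set
Outerplanar G = OuterplanarAdj (adj G)

addEdgeAdj : ∀ {n} → (Fin n → Fin n → Bool) → Fin n → Fin n → Fin n → Fin n → Bool
addEdgeAdj a u v x y =
  a x y ∨ (⌊ x ≟ u ⌋ ∧ ⌊ y ≟ v ⌋) ∨ (⌊ x ≟ v ⌋ ∧ ⌊ y ≟ u ⌋)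

MaximalOuterplanar : ∀ {n} → Graph n → Set
MaximalOuterplanar G =
  Outerplanar G ×
  (∀ u v → u ≢ v → ¬ Adj G u v → ¬ OuterplanarAdj (addEdgeAdj (adj G) u v))

TwoColoured : ∀ {k} → Fin k → Fin k → Fin k → Fin k → Set
TwoColoured {k} c₁ c₂ c₃ c₄ =
  ∃ λ (a : Fin k) → ∃ λ (b : Fin k) →
    (c₁ ≡ a ⊎ c₁ ≡ b) × (c₂ ≡ a ⊎ c₂ ≡ b) ×
    (c₃ ≡ a ⊎ c₃ ≡ b) × (c₄ ≡ a ⊎ c₄ ≡ b)

Path4 : ∀ {n} → Graph n → Fin n → Fin n → Fin n → Fin n → Fin n → Set
Path4 G v₀ v₁ v₂ v₃ v₄ =
  Unique (v₀ ∷ v₁ ∷ v₂ ∷ v₃ ∷ v₄ ∷ []) ×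
  Adj G v₀ v₁ × Adj G v₁ v₂ × Adj G v₂ v₃ × Adj G v₃ v₄

Cycle4 : ∀ {n} → Graph n → Fin n → Fin n → Fin n → Fin n → Set
Cycle4 G v₀ v₁ v₂ v₃ =
  Unique (v₀ ∷ v₁ ∷ v₂ ∷ v₃ ∷ []) ×
  Adj G v₀ v₁ × Adj G v₁ v₂ × Adj G v₂ v₃ × Adj G v₃ v₀

record StarEdgeColouring {n} (G : Graph n) (k : ℕ) : Set where
  field
    col    : Fin n → Fin n → Fin k
    symm   : ∀ u v → Adj G u v → col u v ≡ col v u
    proper : ∀ u v w → Adj G u v → Adj G u w → v ≢ w → col u v ≢ col u w
    noBichromaticPath : ∀ v₀ v₁ v₂ v₃ v₄ → Path4 G v₀ v₁ v₂ v₃ v₄ →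
      ¬ TwoColoured (col v₀ v₁) (col v₁ v₂) (col v₂ v₃) (col v₃ v₄)
    noBichromaticCycle : ∀ v₀ v₁ v₂ v₃ → Cycle4 G v₀ v₁ v₂ v₃ →
      ¬ TwoColoured (col v₀ v₁) (col v₁ v₂) (col v₂ v₃) (col v₃ v₀)

IsStarChromaticIndex : ∀ {n} → Graph n → ℕ → Set
IsStarChromaticIndex G k =
  StarEdgeColouring G k × (∀ m → StarEdgeColouring G m → k ≤ m)

{-# OPTIONS --safe #-}
module Submission where

-- Place the vertices on the circle. If no edge crosses the chord uv, then two vertices on different
-- sides of it, neither of them adjacent to u or v, have distance at least 4; so one side of uv is
-- dominated by {u , v}. Cutting off dominated sides one arrives at three hubs whose chords are
-- uncrossed and whose three arcs are each dominated by their two ends. Every edge then meets a hub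
-- or joins consecutive vertices of an arc (a rim edge), and each arc i contains at most one special
-- vertex xᵢ adjacent to both of its ends hᵢ and hᵢ₊₁.
--
-- Colour the rim periodically with R 0, R 1, R 2, the edges hᵢhᵢ₊₁ with H i, the edges hᵢ₊₁xᵢ with
-- R i, the edge h₂x₂ with H 0, and the remaining hub edges, the spokes, with further colours,
-- injectively at each hub, such that the colour of h₀x₀ is unused by the spokes of h₁ and that of
-- h₁x₁ by the spokes of h₂. A two-coloured path or cycle with four edges would alternate its
-- colours, which is refuted according to which of its inner vertices are hubs. There are at most Δ
-- spoke colours in general, and at most Δ − 2 if the hubs are pairwise adjacent, as they are in the
-- maximal case because an uncrossed chord can be added.

open import Defs
open import Data.Bool using (T; T?; _∧_)
open import Data.Bool.Properties using (T-∨; T-∧)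
open import Data.Empty using (⊥; ⊥-elim)
open import Data.Fin using (Fin; zero; suc; toℕ; fromℕ<; punchOut; funToFin; finToFun)
  renaming (_≟_ to _≟ᶠ_)
open import Data.Fin.Patterns using (0F; 1F; 2F)
import Data.Fin.Properties as Finₚ
open import Data.List
  using (List; []; _∷_; _++_; length; filter; filterᵇ; allFin; map; foldr; lookup)
import Data.List.Properties as Listₚ
open import Data.List.Membership.Propositional using (_∈_)
open import Data.List.Membership.Propositional.Properties
  using (∈-map⁺; ∈-map⁻; ∈-filter⁺; ∈-filter⁻; ∈-allFin; ∈-lookup; ∈-++⁻)
open import Data.List.Relation.Unary.All as All using (All; []; _∷_)
open import Data.List.Relation.Unary.AllPairs using ([]; _∷_)
import Data.List.Relation.Unary.Any as Any∈
import Data.List.Relation.Unary.Any.Properties as Anyₚ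
import Data.List.Relation.Unary.Unique.DecPropositional as DecUnique
open import Data.List.Relation.Unary.Unique.Propositional using (Unique)
import Data.List.Relation.Unary.Unique.Propositional.Properties as Uniqueₚ
open import Data.Nat
  using (ℕ; zero; suc; _≤_; _<_; _⊔_; _⊓_; _+_; _∸_; _^_; z≤n; s≤s; _≟_; _<?_)
import Data.Nat.Properties as ℕₚ
open import Data.Product using (∃; _×_; _,_; proj₁; proj₂)
open import Data.Sum using (_⊎_; inj₁; inj₂)
open import Function using (_∘_; id; Equivalence)
open import Function.Definitions using (Injective)
open import Relation.Binary using (tri<; tri≈; tri>)
open import Relation.Binary.PropositionalEquality
  using (_≡_; _≢_; refl; trans; cong; cong₂; subst; subst₂)
  renaming (sym to ≡-sym)
open import Relation.Nullary using (¬_; Dec; yes; no; contradiction)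
open import Relation.Nullary.Decidable
  using (⌊_⌋; map′; toWitness; decidable-stable; _×-dec_; _⊎-dec_; _→-dec_; ¬?)

-- Existence of the star chromatic index and the lower bound

module _ {A : Set} where

  lookup-injective : ∀ {xs : List A} → Unique xs →
                     ∀ i j → lookup xs i ≡ lookup xs j → i ≡ j
  lookup-injective (_ ∷ _)   zero    zero    _  = refl
  lookup-injective (x∉ ∷ _)  zero    (suc j) eq = contradiction eq (All.lookup x∉ (∈-lookup j))
  lookup-injective (x∉ ∷ _)  (suc i) zero    eq = contradiction (≡-sym eq) (All.lookup x∉ (∈-lookup i))
  lookup-injective (_ ∷ xs!) (suc i) (suc j) eq = cong suc (lookup-injective xs! i j eq)

  -- The position in `ys` of each entry of `xs` is an injection between the index sets.
  Unique-⊆⇒length≤ : ∀ {xs ys : List A} → Unique xs → (∀ {x} → x ∈ xs → x ∈ ys) →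
                     length xs ≤ length ys
  Unique-⊆⇒length≤ {xs} {ys} xs! xs⊆ys =
    Finₚ.injective⇒≤ λ {i} {j} eq → lookup-injective xs! i j
      (trans (at i) (trans (cong (lookup ys) eq) (≡-sym (at j))))
    where
    at : ∀ i → lookup xs i ≡ lookup ys (Any∈.index (xs⊆ys (∈-lookup i)))
    at i = Anyₚ.lookup-index (xs⊆ys (∈-lookup i))

-- A missed value `j` could be punched out, leaving an injection from `Fin (suc n)` to `Fin n`.
injective⇒surjective : ∀ {n} (f : Fin n → Fin n) → (∀ x y → f x ≡ f y → x ≡ y) →
                       ∀ j → ∃ λ i → f i ≡ j
injective⇒surjective {suc n} f f-inj j with Finₚ.any? (λ i → f i ≟ᶠ j)
... | yes hit = hit
... | no miss = contradiction (Finₚ.injective⇒≤ {f = g} g-inj) (ℕₚ.<⇒≱ (ℕₚ.n<1+n n))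
  where
  j≢f : ∀ i → j ≢ f i
  j≢f i j≡fi = miss (i , ≡-sym j≡fi)
  g : Fin (suc n) → Fin n
  g i = punchOut (j≢f i)
  g-inj : Injective _≡_ _≡_ g
  g-inj {x} {y} eq = f-inj x y (Finₚ.punchOut-injective (j≢f x) (j≢f y) eq)

module _ {n} (G : Graph n) where

  Adj-sym : ∀ {u v} → Adj G u v → Adj G v u
  Adj-sym {u} {v} = subst T (sym G u v)

  Adj-irrefl : ∀ {u v} → Adj G u v → u ≢ v
  Adj-irrefl {u} uv refl = subst T (irrefl G u) uv

  Adj? : ∀ u v → Dec (Adj G u v)
  Adj? u v = T? (adj G u v)

  nbrs : Fin n → List (Fin n)
  nbrs v = filterᵇ (adj G v) (allFin n)

  ∈-nbrs : ∀ {v w} → Adj G v w → w ∈ nbrs v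
  ∈-nbrs {v} vw = ∈-filter⁺ (T? ∘ adj G v) (∈-allFin _) vw

  ∈-nbrs⁻ : ∀ {v w} → w ∈ nbrs v → Adj G v w
  ∈-nbrs⁻ {v} w∈ = proj₂ (∈-filter⁻ (T? ∘ adj G v) {xs = allFin n} w∈)

  nbrs-unique : ∀ v → Unique (nbrs v)
  nbrs-unique v = Uniqueₚ.filter⁺ (T? ∘ adj G v) (Uniqueₚ.allFin⁺ n)

  deg-≥ : ∀ v {ws} → Unique ws → (∀ {w} → w ∈ ws → Adj G v w) → length ws ≤ deg G v
  deg-≥ v ws! adj = Unique-⊆⇒length≤ ws! (∈-nbrs ∘ adj)

∈⇒≤max : ∀ {x} {xs : List ℕ} → x ∈ xs → x ≤ foldr _⊔_ 0 xs
∈⇒≤max {x} {_ ∷ xs} (Any∈.here refl) = ℕₚ.m≤m⊔n x _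
∈⇒≤max {x} {y ∷ xs} (Any∈.there x∈) = ℕₚ.≤-trans (∈⇒≤max x∈) (ℕₚ.m≤n⊔m y _)

max≤ : ∀ {m} (xs : List ℕ) → (∀ {x} → x ∈ xs → x ≤ m) → foldr _⊔_ 0 xs ≤ m
max≤ []       _  = z≤n
max≤ (x ∷ xs) le = ℕₚ.⊔-lub (le (Any∈.here refl)) (max≤ xs (le ∘ Any∈.there))

module _ {n} (G : Graph n) where

  deg≤Δ : ∀ v → deg G v ≤ Δ G
  deg≤Δ v = ∈⇒≤max (∈-map⁺ (deg G) (∈-allFin v))

  Δ≤ : ∀ {m} → (∀ v → deg G v ≤ m) → Δ G ≤ m
  Δ≤ {m} le = max≤ _ (λ x∈ → bound (∈-map⁻ (deg G) x∈))
    where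
    bound : ∀ {x} → (∃ λ v → v ∈ allFin n × x ≡ deg G v) → x ≤ m
    bound (v , _ , refl) = le v

  -- Properness makes the colours injective on the neighbours of each vertex.
  colouring⇒Δ≤ : ∀ {m} → StarEdgeColouring G m → Δ G ≤ m
  colouring⇒Δ≤ {m} C = Δ≤ λ v → Finₚ.injective⇒≤ (inj v)
    where
    open StarEdgeColouring C
    inj : ∀ v → Injective _≡_ _≡_ (λ i → col v (lookup (nbrs G v) i))
    inj v {i} {j} eq with lookup (nbrs G v) i ≟ᶠ lookup (nbrs G v) j
    ... | yes p = lookup-injective (nbrs-unique G v) i j p
    ... | no ¬p = contradiction eq
      (proper v _ _ (∈-nbrs⁻ G (∈-lookup i)) (∈-nbrs⁻ G (∈-lookup j)) ¬p)

least : ∀ {P : ℕ → Set} → (∀ k → Dec (P k)) → ∀ {K} → P K →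
        ∃ λ χ → P χ × (∀ m → P m → χ ≤ m) × χ ≤ K
least {P} P? {zero}  p = 0 , p , (λ _ _ → z≤n) , z≤n
least {P} P? {suc K} p with P? 0
... | yes p₀ = 0 , p₀ , (λ _ _ → z≤n) , z≤n
... | no ¬p₀ with least {P ∘ suc} (P? ∘ suc) p
...   | χ , pχ , χ≤ , χ≤K = suc χ , pχ , min , s≤s χ≤K
  where
  min : ∀ m → P m → suc χ ≤ m
  min zero    p₀ = contradiction p₀ ¬p₀
  min (suc m) pm = s≤s (χ≤ m pm)

module _ {n} (G : Graph n) {k : ℕ} where

  TwoColoured? : ∀ (c₁ c₂ c₃ c₄ : Fin k) → Dec (TwoColoured c₁ c₂ c₃ c₄)
  TwoColoured? c₁ c₂ c₃ c₄ = Finₚ.any? λ a → Finₚ.any? λ b →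
    (c₁ ≟ᶠ a ⊎-dec c₁ ≟ᶠ b) ×-dec (c₂ ≟ᶠ a ⊎-dec c₂ ≟ᶠ b) ×-dec
    (c₃ ≟ᶠ a ⊎-dec c₃ ≟ᶠ b) ×-dec (c₄ ≟ᶠ a ⊎-dec c₄ ≟ᶠ b)

  Path4? : ∀ v₀ v₁ v₂ v₃ v₄ → Dec (Path4 G v₀ v₁ v₂ v₃ v₄)
  Path4? v₀ v₁ v₂ v₃ v₄ = DecUnique.unique? _≟ᶠ_ _ ×-dec
    Adj? G v₀ v₁ ×-dec Adj? G v₁ v₂ ×-dec Adj? G v₂ v₃ ×-dec Adj? G v₃ v₄

  Cycle4? : ∀ v₀ v₁ v₂ v₃ → Dec (Cycle4 G v₀ v₁ v₂ v₃)
  Cycle4? v₀ v₁ v₂ v₃ = DecUnique.unique? _≟ᶠ_ _ ×-dec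
    Adj? G v₀ v₁ ×-dec Adj? G v₁ v₂ ×-dec Adj? G v₂ v₃ ×-dec Adj? G v₃ v₀

  IsStar : (Fin n → Fin n → Fin k) → Set
  IsStar col =
    (∀ u v → Adj G u v → col u v ≡ col v u) ×
    (∀ u v w → Adj G u v → Adj G u w → v ≢ w → col u v ≢ col u w) ×
    (∀ v₀ v₁ v₂ v₃ v₄ → Path4 G v₀ v₁ v₂ v₃ v₄ →
      ¬ TwoColoured (col v₀ v₁) (col v₁ v₂) (col v₂ v₃) (col v₃ v₄)) ×
    (∀ v₀ v₁ v₂ v₃ → Cycle4 G v₀ v₁ v₂ v₃ →
      ¬ TwoColoured (col v₀ v₁) (col v₁ v₂) (col v₂ v₃) (col v₃ v₀))

  IsStar? : ∀ col → Dec (IsStar col)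
  IsStar? col =
    (Finₚ.all? λ u → Finₚ.all? λ v → Adj? G u v →-dec col u v ≟ᶠ col v u) ×-dec
    (Finₚ.all? λ u → Finₚ.all? λ v → Finₚ.all? λ w →
      Adj? G u v →-dec Adj? G u w →-dec ¬? (v ≟ᶠ w) →-dec ¬? (col u v ≟ᶠ col u w)) ×-dec
    (Finₚ.all? λ v₀ → Finₚ.all? λ v₁ → Finₚ.all? λ v₂ → Finₚ.all? λ v₃ → Finₚ.all? λ v₄ →
      Path4? v₀ v₁ v₂ v₃ v₄ →-dec ¬? (TwoColoured? _ _ _ _)) ×-dec
    (Finₚ.all? λ v₀ → Finₚ.all? λ v₁ → Finₚ.all? λ v₂ → Finₚ.all? λ v₃ →
      Cycle4? v₀ v₁ v₂ v₃ →-dec ¬? (TwoColoured? _ _ _ _))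

  -- Decoding an encoded colouring recovers it only pointwise, so the star property has to be
  -- transported along pointwise equality.
  IsStar-resp : ∀ {c d} → (∀ u v → c u v ≡ d u v) → IsStar c → IsStar d
  IsStar-resp {c} {d} c≗d (symm , proper , path , cycle) =
    (λ u v uv → trans (≡-sym (c≗d u v)) (trans (symm u v uv) (c≗d v u))) ,
    (λ u v w uv uw v≢w eq →
      proper u v w uv uw v≢w (trans (c≗d u v) (trans eq (≡-sym (c≗d u w))))) ,
    (λ v₀ v₁ v₂ v₃ v₄ P tc → path v₀ v₁ v₂ v₃ v₄ P
      (two (c≗d v₀ v₁) (c≗d v₁ v₂) (c≗d v₂ v₃) (c≗d v₃ v₄) tc)) ,
    (λ v₀ v₁ v₂ v₃ P tc → cycle v₀ v₁ v₂ v₃ P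
      (two (c≗d v₀ v₁) (c≗d v₁ v₂) (c≗d v₂ v₃) (c≗d v₃ v₀) tc))
    where
    two : ∀ {a b c d a′ b′ c′ d′ : Fin k} → a ≡ a′ → b ≡ b′ → c ≡ c′ → d ≡ d′ →
          TwoColoured a′ b′ c′ d′ → TwoColoured a b c d
    two refl refl refl refl tc = tc

  toColouring : ∀ {col} → IsStar col → StarEdgeColouring G k
  toColouring {col} (symm , proper , path , cycle) = record
    { col = col ; symm = symm ; proper = proper
    ; noBichromaticPath = path ; noBichromaticCycle = cycle }

  -- The maps `Fin n → Fin n → Fin k` are numbered by `Fin ((k ^ n) ^ n)`, which turns the existence
  -- of a star colouring into a finite search.
  decode : Fin ((k ^ n) ^ n) → Fin n → Fin n → Fin k
  decode i u = finToFun (finToFun {m = k ^ n} {n = n} i u)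

  encode : (Fin n → Fin n → Fin k) → Fin ((k ^ n) ^ n)
  encode c = funToFin {m = n} {n = k ^ n} (λ u → funToFin (c u))

  decode-encode : ∀ c u v → decode (encode c) u v ≡ c u v
  decode-encode c u v = trans
    (cong (λ i → finToFun {m = k} {n = n} i v) (Finₚ.finToFun-funToFin (λ u → funToFin (c u)) u))
    (Finₚ.finToFun-funToFin (c u) v)

  StarEdgeColouring? : Dec (StarEdgeColouring G k)
  StarEdgeColouring? = map′
    (λ (_ , star) → toColouring star)
    (λ C → let open StarEdgeColouring C in
      encode col ,
      IsStar-resp (λ u v → ≡-sym (decode-encode col u v))
        (symm , proper , noBichromaticPath , noBichromaticCycle))
    (Finₚ.any? (λ i → IsStar? (decode i)))

starChromaticIndex : ∀ {n} (G : Graph n) {K} → StarEdgeColouring G K →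
                     ∃ λ χ → IsStarChromaticIndex G χ × Δ G ≤ χ × χ ≤ K
starChromaticIndex G C with least (λ k → StarEdgeColouring? G {k}) C
... | χ , Cχ , χ≤ , χ≤K = χ , (Cχ , χ≤) , colouring⇒Δ≤ G Cχ , χ≤K

-- Colouring a graph with three hubs

next prev : Fin 3 → Fin 3
next 0F = 1F
next 1F = 2F
next 2F = 0F
prev 0F = 2F
prev 1F = 0F
prev 2F = 1F

prev-next : ∀ i → prev (next i) ≡ i
prev-next 0F = refl
prev-next 1F = refl
prev-next 2F = refl

next-prev : ∀ i → next (prev i) ≡ i
next-prev 0F = refl
next-prev 1F = refl
next-prev 2F = refl

prev≢ : ∀ i → prev i ≢ i
prev≢ 0F ()
prev≢ 1F ()
prev≢ 2F ()

next≢ : ∀ i → next i ≢ i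
next≢ 0F ()
next≢ 1F ()
next≢ 2F ()

prev≢next : ∀ i → prev i ≢ next i
prev≢next 0F ()
prev≢next 1F ()
prev≢next 2F ()

prev²≢ : ∀ i → prev (prev i) ≢ i
prev²≢ 0F ()
prev²≢ 1F ()
prev²≢ 2F ()

prev-injective : ∀ {i j} → prev i ≡ prev j → i ≡ j
prev-injective {i} {j} eq = trans (≡-sym (next-prev i)) (trans (cong next eq) (next-prev j))

≢⇒next : ∀ {i j} → i ≢ j → j ≡ next i ⊎ i ≡ next j
≢⇒next {0F} {0F} i≢j = contradiction refl i≢j
≢⇒next {0F} {1F} _   = inj₁ refl
≢⇒next {0F} {2F} _   = inj₂ refl
≢⇒next {1F} {0F} _   = inj₂ refl
≢⇒next {1F} {1F} i≢j = contradiction refl i≢j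
≢⇒next {1F} {2F} _   = inj₁ refl
≢⇒next {2F} {0F} _   = inj₁ refl
≢⇒next {2F} {1F} _   = inj₂ refl
≢⇒next {2F} {2F} i≢j = contradiction refl i≢j

-- A path on all three hubs that continues to a further vertex at both ends does not alternate:
-- j colours the edge from h k to h l, i the edge from h l to h m.
triangle-tail : ∀ k l m i j →
  (l ≡ next k × j ≡ k) ⊎ (l ≡ prev k × j ≡ prev k) →
  (m ≡ next l × i ≡ l) ⊎ (m ≡ prev l × i ≡ prev l) → k ≢ m →
  i ≡ k ⊎ i ≡ prev k ⊎ (k ≡ 2F × i ≡ 0F) →
  ¬ (j ≡ m ⊎ j ≡ prev m ⊎ (m ≡ 2F × j ≡ 0F))
triangle-tail = toWitness {a? = Finₚ.all? λ k → Finₚ.all? λ l → Finₚ.all? λ m →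
  Finₚ.all? λ i → Finₚ.all? λ j →
  ((l ≟ᶠ next k ×-dec j ≟ᶠ k) ⊎-dec (l ≟ᶠ prev k ×-dec j ≟ᶠ prev k)) →-dec
  ((m ≟ᶠ next l ×-dec i ≟ᶠ l) ⊎-dec (m ≟ᶠ prev l ×-dec i ≟ᶠ prev l)) →-dec
  ¬? (k ≟ᶠ m) →-dec
  (i ≟ᶠ k ⊎-dec i ≟ᶠ prev k ⊎-dec (k ≟ᶠ 2F ×-dec i ≟ᶠ 0F)) →-dec
  ¬? (j ≟ᶠ m ⊎-dec j ≟ᶠ prev m ⊎-dec (m ≟ᶠ 2F ×-dec j ≟ᶠ 0F))} _

-- Arc i runs from h i to h (next i), and κ increases along it.
record Frame {n} (G : Graph n) : Set where
  field
    h     : Fin 3 → Fin n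
    h-inj : ∀ {k l} → h k ≡ h l → k ≡ l
    arc   : Fin n → Fin 3
    κ     : Fin n → ℕ
    κ-inj : ∀ {u v} → κ u ≡ κ v → u ≡ v

  NonHub : Fin n → Set
  NonHub v = ∀ k → v ≢ h k

  field
    rim-arc   : ∀ {u v} → NonHub u → NonHub v → Adj G u v → arc u ≡ arc v
    rim-κ     : ∀ {u v} → NonHub u → NonHub v → Adj G u v →
                κ v ≡ suc (κ u) ⊎ κ u ≡ suc (κ v)
    spoke-arc : ∀ {k v} → NonHub v → Adj G (h k) v → arc v ≡ k ⊎ arc v ≡ prev k
    arc-order : ∀ {k u v} → NonHub u → NonHub v → arc u ≡ k → arc v ≡ k →
                Adj G (h k) u → Adj G (h (next k)) v → κ u ≤ κ v

-- An upper bound of `κ` is lowered until a vertex satisfying `P` attains it.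
argmax : ∀ {n} (κ : Fin n → ℕ) {P : Fin n → Set} → (∀ v → Dec (P v)) → ∀ {v} → P v →
         ∃ λ w → P w × (∀ x → P x → κ x ≤ κ w)
argmax {n} κ {P} P? {v} Pv = go B (λ x _ → bound x)
  where
  B = foldr _⊔_ 0 (map κ (allFin n))
  bound : ∀ x → κ x ≤ B
  bound x = ∈⇒≤max (∈-map⁺ κ (∈-allFin x))
  go : ∀ m → (∀ x → P x → κ x ≤ m) → ∃ λ w → P w × (∀ x → P x → κ x ≤ κ w)
  go m κ≤m with Finₚ.any? (λ w → P? w ×-dec κ w ≟ m)
  ... | yes (w , Pw , refl) = w , Pw , κ≤m
  go zero    κ≤m | no none = contradiction (v , Pv , ℕₚ.n≤0⇒n≡0 (κ≤m v Pv)) none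
  go (suc m) κ≤m | no none = go m λ x Px →
    ℕₚ.≤-pred (ℕₚ.≤∧≢⇒< (κ≤m x Px) (λ eq → none (x , Px , eq)))

-- Transpositions and ranks, for numbering the spokes

swap : ℕ → ℕ → ℕ → ℕ
swap i j n with n ≟ i
... | yes _ = j
... | no  _ with n ≟ j
...   | yes _ = i
...   | no  _ = n

swap-left : ∀ i j → swap i j i ≡ j
swap-left i j with i ≟ i
... | yes _ = refl
... | no ¬p = contradiction refl ¬p

swap-injective : ∀ i j {m n} → swap i j m ≡ swap i j n → m ≡ n
swap-injective i j {m} {n} eq with m ≟ i | n ≟ i
... | yes p | yes q = trans p (≡-sym q)
... | yes p | no ¬q with n ≟ j
...   | yes r = contradiction (trans r eq) ¬q
...   | no ¬r = contradiction (≡-sym eq) ¬r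
swap-injective i j {m} {n} eq | no ¬p | yes q with m ≟ j
...   | yes r = contradiction (trans r (≡-sym eq)) ¬p
...   | no ¬r = contradiction eq ¬r
swap-injective i j {m} {n} eq | no ¬p | no ¬q with m ≟ j | n ≟ j
...   | yes r | yes s = trans r (≡-sym s)
...   | yes r | no ¬s = contradiction (≡-sym eq) ¬q
...   | no ¬r | yes s = contradiction eq ¬p
...   | no ¬r | no ¬s = eq

swap-< : ∀ {i j n k} → i < k → j < k → n < k → swap i j n < k
swap-< {i} {j} {n} i<k j<k n<k with n ≟ i
... | yes _ = j<k
... | no  _ with n ≟ j
...   | yes _ = i<k
...   | no  _ = n<k

module _ {n : ℕ} where

  rank : List (Fin n) → Fin n → ℕ
  rank []       v = 0
  rank (x ∷ xs) v with v ≟ᶠ x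
  ... | yes _ = 0
  ... | no  _ = suc (rank xs v)

  rank-< : ∀ {xs v} → v ∈ xs → rank xs v < length xs
  rank-< {x ∷ xs} {v} v∈ with v ≟ᶠ x
  ... | yes _ = s≤s z≤n
  rank-< (Any∈.here v≡x)  | no v≢x = contradiction v≡x v≢x
  rank-< (Any∈.there v∈)  | no v≢x = s≤s (rank-< v∈)

  rank-injective : ∀ {xs u v} → u ∈ xs → v ∈ xs → rank xs u ≡ rank xs v → u ≡ v
  rank-injective {x ∷ xs} {u} {v} u∈ v∈ eq with u ≟ᶠ x | v ≟ᶠ x
  ... | yes p | yes q = trans p (≡-sym q)
  rank-injective (Any∈.here p)   _              eq | no ¬p | no ¬q = contradiction p ¬p
  rank-injective (Any∈.there _)  (Any∈.here q)  eq | no ¬p | no ¬q = contradiction q ¬q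
  rank-injective (Any∈.there u∈) (Any∈.there v∈) eq | no ¬p | no ¬q =
    rank-injective u∈ v∈ (ℕₚ.suc-injective eq)

-- R i colours the rim, H i the edges between hubs, S s the spokes.
data Col : Set where
  R H : Fin 3 → Col
  S   : ℕ → Col

R-injective : ∀ {i j} → R i ≡ R j → i ≡ j
R-injective refl = refl

-- The six colours `R i` and `H i` come first, so spoke colours below `m` give `6 + m` colours in
-- all.
code : Col → ℕ
code (R i) = toℕ i
code (H i) = 3 + toℕ i
code (S s) = 6 + s

code-injective : ∀ {c d} → code c ≡ code d → c ≡ d
code-injective {R i} {R j} eq = cong R (Finₚ.toℕ-injective eq)
code-injective {R i} {H j} eq = contradiction (subst (_< 3) eq (Finₚ.toℕ<n i)) (ℕₚ.m+n≮m 3 _)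
code-injective {R i} {S s} eq = contradiction (subst (_< 3) eq (Finₚ.toℕ<n i)) (ℕₚ.m+n≮m 3 _)
code-injective {H i} {R j} eq = contradiction (subst (_< 3) (≡-sym eq) (Finₚ.toℕ<n j)) (ℕₚ.m+n≮m 3 _)
code-injective {H i} {H j} eq = cong H (Finₚ.toℕ-injective (ℕₚ.+-cancelˡ-≡ 3 _ _ eq))
code-injective {H i} {S s} eq =
  contradiction (subst (_< 3) (ℕₚ.+-cancelˡ-≡ 3 _ _ eq) (Finₚ.toℕ<n i)) (ℕₚ.m+n≮m 3 _)
code-injective {S s} {R j} eq = contradiction (subst (_< 3) (≡-sym eq) (Finₚ.toℕ<n j)) (ℕₚ.m+n≮m 3 _)
code-injective {S s} {H j} eq =
  contradiction (subst (_< 3) (≡-sym (ℕₚ.+-cancelˡ-≡ 3 _ _ eq)) (Finₚ.toℕ<n j)) (ℕₚ.m+n≮m 3 _)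
code-injective {S s} {S t} eq = cong S (ℕₚ.+-cancelˡ-≡ 6 _ _ eq)

-- A colouring also assigns values to nonadjacent pairs; their codes may be out of range and then
-- become `zero`. Codes of edges are in range by `code-<`.
clamp : ∀ m → ℕ → Fin (suc m)
clamp m i with i <? suc m
... | yes i<m = fromℕ< i<m
... | no  _   = zero

clamp-injective : ∀ {m i j} → i < suc m → j < suc m → clamp m i ≡ clamp m j → i ≡ j
clamp-injective {m} {i} {j} i< j< eq with i <? suc m | j <? suc m
... | yes p | yes q = Finₚ.fromℕ<-injective i j p q eq
... | no ¬p | _     = contradiction i< ¬p
... | yes _ | no ¬q = contradiction j< ¬q

two-colours-alternate : ∀ {k} {c₁ c₂ c₃ c₄ : Fin k} → TwoColoured c₁ c₂ c₃ c₄ →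
  c₁ ≢ c₂ → c₂ ≢ c₃ → c₃ ≢ c₄ → c₁ ≡ c₃ × c₂ ≡ c₄
two-colours-alternate (a , b , p₁ , p₂ , p₃ , p₄) n₁₂ n₂₃ n₃₄ =
  third p₁ p₂ p₃ n₁₂ n₂₃ , third p₂ p₃ p₄ n₂₃ n₃₄
  where
  third : ∀ {x y z} → x ≡ a ⊎ x ≡ b → y ≡ a ⊎ y ≡ b → z ≡ a ⊎ z ≡ b →
          x ≢ y → y ≢ z → x ≡ z
  third (inj₁ refl) (inj₁ refl) _           x≢y _   = contradiction refl x≢y
  third (inj₁ refl) (inj₂ refl) (inj₁ refl) _   _   = refl
  third (inj₁ refl) (inj₂ refl) (inj₂ refl) _   y≢z = contradiction refl y≢z
  third (inj₂ refl) (inj₂ refl) _           x≢y _   = contradiction refl x≢y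
  third (inj₂ refl) (inj₁ refl) (inj₂ refl) _   _   = refl
  third (inj₂ refl) (inj₁ refl) (inj₁ refl) _   y≢z = contradiction refl y≢z

-- Special vertices, spokes and the periodic colouring of the rim

module Colouring {n} {G : Graph n} (F : Frame G) where
  open Frame F

  hub? : ∀ v → (∃ λ k → v ≡ h k) ⊎ NonHub v
  hub? v with Finₚ.any? (λ k → v ≟ᶠ h k)
  ... | yes hub = inj₁ hub
  ... | no ¬hub = inj₂ λ k eq → ¬hub (k , eq)

  NonHub? : ∀ v → Dec (NonHub v)
  NonHub? v = Finₚ.all? λ k → ¬? (v ≟ᶠ h k)

  Special : Fin 3 → Fin n → Set
  Special i v = NonHub v × Adj G (h i) v × Adj G (h (next i)) v

  Special? : ∀ i v → Dec (Special i v)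
  Special? i v = NonHub? v ×-dec Adj? G (h i) v ×-dec Adj? G (h (next i)) v

  -- Among nonhub vertices, `h i` reaches only the arcs `i` and `prev i`, and `h (next i)` only
  -- `next i` and `i`.
  special-arc : ∀ {i v} → Special i v → arc v ≡ i
  special-arc {i} (nv , iv , i′v) with spoke-arc nv iv | spoke-arc nv i′v
  ... | inj₁ p | _      = p
  ... | inj₂ p | inj₁ q = contradiction (trans (≡-sym p) q) (prev≢next i)
  ... | inj₂ _ | inj₂ q = trans q (prev-next i)

  -- `arc-order` applies in both directions, since each of the two vertices is adjacent to both ends
  -- of the arc.
  special-unique : ∀ {i u v} → Special i u → Special i v → u ≡ v
  special-unique su@(nu , iu , i′u) sv@(nv , iv , i′v) = κ-inj (ℕₚ.≤-antisym
    (arc-order nu nv (special-arc su) (special-arc sv) iu i′v)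
    (arc-order nv nu (special-arc sv) (special-arc su) iv i′u))

  special-third : ∀ {i v} → Special i v → ¬ Adj G (h (prev i)) v
  special-third {i} sv@(nv , _) pv with spoke-arc nv pv
  ... | inj₁ p = contradiction (trans (≡-sym p) (special-arc sv)) (prev≢ i)
  ... | inj₂ p = contradiction (trans (≡-sym p) (special-arc sv)) (prev²≢ i)

  -- The hub edges to nonhub vertices that are not given one of the six special colours: h (next i)
  -- to the special vertex of arc i gets R i, and h 2 to the special vertex of arc 2 gets H 0.
  Spoke : Fin 3 → Fin n → Set
  Spoke k v = NonHub v × Adj G (h k) v × ¬ Adj G (h (prev k)) v × (k ≡ 2F → ¬ Adj G (h 0F) v)

  Spoke? : ∀ k v → Dec (Spoke k v)
  Spoke? k v = NonHub? v ×-dec Adj? G (h k) v ×-dec ¬? (Adj? G (h (prev k)) v) ×-dec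
               (k ≟ᶠ 2F →-dec ¬? (Adj? G (h 0F) v))

  special⇒spoke : ∀ {i v} → i ≢ 2F → Special i v → Spoke i v
  special⇒spoke i≢2 sv@(nv , iv , _) = nv , iv , special-third sv , λ i≡2 → contradiction i≡2 i≢2

  spoke-next : ∀ {k v} → Spoke (next k) v → ¬ Adj G (h k) v
  spoke-next {k} {v} (_ , _ , ¬pv , _) = subst (λ i → ¬ Adj G (h i) v) (prev-next k) ¬pv

  -- Of two distinct hubs one is `next` of the other, and a spoke of the later hub is not adjacent
  -- to the earlier one.
  spoke-disjoint : ∀ {k l v} → Spoke k v → Spoke l v → k ≡ l
  spoke-disjoint {k} {l} sk@(_ , kv , _) sl@(_ , lv , _) with k ≟ᶠ l
  ... | yes p = p
  ... | no ¬p with ≢⇒next ¬p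
  ...   | inj₁ refl = contradiction kv (spoke-next sl)
  ...   | inj₂ refl = contradiction lv (spoke-next sk)

  spokes : Fin 3 → List (Fin n)
  spokes k = filter (Spoke? k) (allFin n)

  ∈-spokes : ∀ {k v} → Spoke k v → v ∈ spokes k
  ∈-spokes {k} sv = ∈-filter⁺ (Spoke? k) (∈-allFin _) sv

  Rim : Fin n → Fin n → Set
  Rim u v = NonHub u × NonHub v × Adj G u v

  Rim-sym : ∀ {u v} → Rim u v → Rim v u
  Rim-sym (nu , nv , uv) = nv , nu , Adj-sym G uv

  LeftFan : Fin 3 → Fin n → Set
  LeftFan i u = NonHub u × arc u ≡ i × Adj G (h i) u

  LeftFan? : ∀ i u → Dec (LeftFan i u)
  LeftFan? i u = NonHub? u ×-dec arc u ≟ᶠ i ×-dec Adj? G (h i) u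

  Last : Fin 3 → Fin n → Set
  Last i u = LeftFan i u × (∀ w → LeftFan i w → κ w ≤ κ u)

  Last? : ∀ i u → Dec (Last i u)
  Last? i u = LeftFan? i u ×-dec Finₚ.all? λ w → LeftFan? i w →-dec κ w ℕₚ.≤? κ u

  Last-unique : ∀ {i u v} → Last i u → Last i v → u ≡ v
  Last-unique (pu , mu) (pv , mv) = κ-inj (ℕₚ.≤-antisym (mv _ pu) (mu _ pv))

  iter : (Fin 3 → Fin 3) → ℕ → Fin 3 → Fin 3
  iter f zero    x = x
  iter f (suc m) x = f (iter f m x)

  iter-prev-next : ∀ m x → iter prev m (iter next m x) ≡ x
  iter-prev-next zero    x = refl
  iter-prev-next (suc m) x = trans (prev-iter m (next (iter next m x)))
    (trans (cong (iter prev m) (prev-next _)) (iter-prev-next m x))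
    where
    prev-iter : ∀ m y → prev (iter prev m y) ≡ iter prev m (prev y)
    prev-iter zero    y = refl
    prev-iter (suc m) y = cong prev (prev-iter m y)

  start : Fin 3 → Fin 3
  start i with Finₚ.any? (Last? i)
  -- The `κ u` applications of `prev` in `ρ` undo this iteration and leave `next i`. If `h i` has no
  -- last neighbour on the arc, the phase is arbitrary.
  ... | yes (u , _) = iter next (κ u) (next i)
  ... | no  _       = 0F

  -- The colour of the rim edge of arc i that leaves position j upwards. With the phase chosen in
  -- start, the edge leaving the last neighbour of h i has colour next i, the one entering it
  -- colour prev i, so that a special vertex of arc i meets no rim edge of colour i.
  ρ : Fin 3 → ℕ → Fin 3
  ρ i j = iter prev j (start i)

  ρ-last : ∀ {i u} → Last i u → ρ i (κ u) ≡ next i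
  ρ-last {i} {u} lu with Finₚ.any? (Last? i)
  ... | yes (v , lv) rewrite Last-unique {i} {u} {v} lu lv = iter-prev-next (κ v) (next i)
  ... | no ¬l = contradiction (u , lu) ¬l

  rc : Fin n → Fin n → Fin 3
  rc u v = ρ (arc u) (κ u ⊓ κ v)

  rc-sym : ∀ {u v} → Rim u v → rc u v ≡ rc v u
  rc-sym {u} {v} (nu , nv , uv) = cong₂ ρ (rim-arc nu nv uv) (ℕₚ.⊓-comm (κ u) (κ v))

  data Step (u v : Fin n) : Set where
    up   : κ v ≡ suc (κ u) → rc u v ≡ ρ (arc u) (κ u) → Step u v
    down : κ u ≡ suc (κ v) → rc u v ≡ ρ (arc u) (κ v) → Step u v

  rim-step : ∀ {u v} → Rim u v → Step u v
  rim-step {u} {v} (nu , nv , uv) with rim-κ nu nv uv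
  ... | inj₁ p = up p (cong (ρ (arc u)) (ℕₚ.m≤n⇒m⊓n≡m (subst (κ u ≤_) (≡-sym p) (ℕₚ.n≤1+n _))))
  ... | inj₂ p = down p (cong (ρ (arc u)) (ℕₚ.m≥n⇒m⊓n≡n (subst (κ v ≤_) (≡-sym p) (ℕₚ.n≤1+n _))))

  rim-same-arc : ∀ {u v} → Rim u v → arc u ≡ arc v
  rim-same-arc (nu , nv , uv) = rim-arc nu nv uv

  rim-proper : ∀ {u v w} → Rim u v → Rim u w → v ≢ w → rc u v ≢ rc u w
  rim-proper {u} uv uw v≢w eq with rim-step uv | rim-step uw
  ... | up p _   | up q _   = v≢w (κ-inj (trans p (≡-sym q)))
  ... | down p _ | down q _ = v≢w (κ-inj (ℕₚ.suc-injective (trans (≡-sym p) q)))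
  ... | up p c   | down q d = prev≢ _
    (trans (cong (ρ (arc u)) (≡-sym q)) (trans (≡-sym c) (trans eq d)))
  ... | down p c | up q d   = prev≢ _
    (trans (cong (ρ (arc u)) (≡-sym p)) (trans (≡-sym d) (trans (≡-sym eq) c)))

  -- The path cannot turn back, as `κ` is injective, so its first and third edges are two positions
  -- apart and their colours differ by two applications of `prev`.
  rim-path : ∀ {u₀ u₁ u₂ u₃} → Rim u₀ u₁ → Rim u₁ u₂ → Rim u₂ u₃ → u₀ ≢ u₂ → u₁ ≢ u₃ →
             rc u₀ u₁ ≢ rc u₂ u₃
  rim-path {u₀} {u₁} {u₂} {u₃} r₀ r₁ r₂ n₀ n₁ eq
    with rim-step r₀ | rim-step r₁ | rim-step r₂
  ... | up p _   | down q _ | _        = n₀ (κ-inj (ℕₚ.suc-injective (trans (≡-sym p) q)))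
  ... | down p _ | up q _   | _        = n₀ (κ-inj (trans p (≡-sym q)))
  ... | _        | up q _   | down r _ = n₁ (κ-inj (ℕₚ.suc-injective (trans (≡-sym q) r)))
  ... | _        | down q _ | up r _   = n₁ (κ-inj (trans q (≡-sym r)))
  ... | up p c   | up q _   | up r d   = prev²≢ _
    (trans (cong₂ ρ (trans (rim-same-arc r₀) (rim-same-arc r₁)) (≡-sym (trans q (cong suc p))))
           (trans (≡-sym d) (trans (≡-sym eq) c)))
  ... | down p c | down q _ | down r d = prev²≢ _
    (trans (cong₂ ρ (≡-sym (trans (rim-same-arc r₀) (rim-same-arc r₁))) (≡-sym (trans q (cong suc r))))
           (trans (≡-sym c) (trans eq d)))

  -- By `arc-order`, `u` is the last neighbour of `h i` on arc `i`, so a rim edge at `u` has colour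
  -- `next i` upwards and `prev i` downwards.
  rim-special : ∀ {i u v} → Special i u → Rim u v → rc u v ≢ i
  rim-special {i} {u} {v} su@(nu , iu , i′u) uv eq = go (rim-step uv)
    where
    last : Last i u
    last = (nu , special-arc su , iu) ,
           λ w (nw , aw , iw) → arc-order nw nu aw (special-arc su) iw i′u
    last-colour : ρ (arc u) (κ u) ≡ next i
    last-colour = trans (cong (λ a → ρ a (κ u)) (special-arc su)) (ρ-last last)
    go : Step u v → ⊥
    go (up _ c)   = next≢ i (trans (≡-sym last-colour) (trans (≡-sym c) eq))
    go (down p c) = prev≢next i (trans (cong prev (trans (≡-sym eq) c))
      (trans (cong (ρ (arc u)) (≡-sym p)) last-colour))

  -- Every neighbour of `h k` on arc `k` comes strictly before `v`, which is not itself adjacent to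
  -- `h k`. Hence `u` is the last such neighbour and the edge leaves it upwards.
  rim-cross : ∀ {k u v} → Spoke k u → Spoke (next k) v → Rim u v → rc u v ≡ next k
  rim-cross {k} {u} {v} (nu , ku , _) sv@(nv , k′v , _) uv = go (rim-step uv)
    where
    arc-u : arc u ≡ k
    arc-u with spoke-arc nu ku | spoke-arc nv k′v
    ... | inj₁ p | _      = p
    ... | inj₂ p | inj₁ q =
      contradiction (trans (≡-sym p) (trans (rim-same-arc uv) q)) (prev≢next k)
    ... | inj₂ _ | inj₂ q = trans (rim-same-arc uv) (trans q (prev-next k))
    arc-v : arc v ≡ k
    arc-v = trans (≡-sym (rim-same-arc uv)) arc-u
    before : ∀ w → NonHub w × arc w ≡ k × Adj G (h k) w → κ w < κ v
    before w (nw , aw , kw) = ℕₚ.≤∧≢⇒< (arc-order nw nv aw arc-v kw k′v)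
      (λ eq → spoke-next sv (subst (Adj G (h k)) (κ-inj eq) kw))
    go : Step u v → rc u v ≡ next k
    go (up p c) = trans c (trans (cong (λ a → ρ a (κ u)) arc-u)
      (ρ-last ((nu , arc-u , ku) , λ w pw → ℕₚ.≤-pred (subst (κ w <_) p (before w pw)))))
    go (down p _) = contradiction (before u (nu , arc-u , ku))
      (ℕₚ.<-asym (subst (κ v <_) (≡-sym p) (ℕₚ.n<1+n _)))

  -- The colouring obtained from a numbering of the spokes

  module _ (f : Fin 3 → Fin n → ℕ)
           (f-inj : ∀ {k u v} → Spoke k u → Spoke k v → f k u ≡ f k v → u ≡ v)
           (f-sep : ∀ {k u v} → k ≢ 2F → Special k u → Spoke (next k) v → f k u ≢ f (next k) v)
           where

    -- The colouring around hub `k` as a relation between the other end and the colour, so that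
    -- walks can be refuted by cases on their colours.
    At : Fin 3 → Fin n → Col → Set
    At k v (R i) = i ≡ prev k × Special i v
    At k v (H j) = (v ≡ h (next k) × j ≡ k) ⊎ (v ≡ h (prev k) × j ≡ prev k) ⊎
                   (k ≡ 2F × j ≡ 0F × Special 2F v)
    At k v (S s) = Spoke k v × s ≡ f k v

    at⇒adj : ∀ {k v} c → NonHub v → At k v c → Adj G (h k) v
    at⇒adj {k} {v} (R i) nv (refl , _ , _ , kv) = subst (λ j → Adj G (h j) v) (next-prev k) kv
    at⇒adj (H j) nv (inj₁ (p , _))                  = contradiction p (nv _)
    at⇒adj (H j) nv (inj₂ (inj₁ (p , _)))           = contradiction p (nv _)
    at⇒adj (H j) nv (inj₂ (inj₂ (refl , _ , _ , kv , _))) = kv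
    at⇒adj (S s) nv ((_ , kv , _) , _) = kv

    -- Properness at a hub. The edges from `h 2F` to the other hubs have colours `H 2F` and `H 1F`,
    -- which leaves `H 0F` for its special vertex.
    at-unique : ∀ {k v w} c → At k v c → At k w c → v ≡ w
    at-unique (R i) (_ , sv) (_ , sw) = special-unique sv sw
    at-unique (H j) (inj₁ (p , _)) (inj₁ (q , _)) = trans p (≡-sym q)
    at-unique {k} (H j) (inj₁ (_ , p)) (inj₂ (inj₁ (_ , q))) =
      contradiction (trans (≡-sym q) p) (prev≢ k)
    at-unique (H j) (inj₁ (_ , p)) (inj₂ (inj₂ (refl , refl , _))) = contradiction p λ ()
    at-unique {k} (H j) (inj₂ (inj₁ (_ , q))) (inj₁ (_ , p)) =
      contradiction (trans (≡-sym q) p) (prev≢ k)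
    at-unique (H j) (inj₂ (inj₂ (refl , refl , _))) (inj₁ (_ , p)) = contradiction p λ ()
    at-unique (H j) (inj₂ (inj₁ (p , _))) (inj₂ (inj₁ (q , _))) = trans p (≡-sym q)
    at-unique (H j) (inj₂ (inj₁ (_ , p))) (inj₂ (inj₂ (refl , refl , _))) = contradiction p λ ()
    at-unique (H j) (inj₂ (inj₂ (refl , refl , _))) (inj₂ (inj₁ (_ , p))) = contradiction p λ ()
    at-unique (H j) (inj₂ (inj₂ (_ , _ , sv))) (inj₂ (inj₂ (_ , _ , sw))) = special-unique sv sw
    at-unique (S s) (sv , p) (sw , q) = f-inj sv sw (trans (≡-sym p) q)

    at-H : ∀ {k v j} → NonHub v → At k v (H j) → k ≡ 2F × j ≡ 0F × Special 2F v
    at-H nv (inj₁ (p , _))        = contradiction p (nv _)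
    at-H nv (inj₂ (inj₁ (p , _))) = contradiction p (nv _)
    at-H nv (inj₂ (inj₂ e))       = e

    -- A nonhub vertex meets `R i` only from `h (next i)` and an `H` colour only from `h 2F`, and it
    -- is a spoke of at most one hub.
    at-hub : ∀ {k l v} c → NonHub v → At k v c → At l v c → k ≡ l
    at-hub (R i) nv (p , _) (q , _) = prev-injective (trans (≡-sym p) q)
    at-hub (H j) nv p q = trans (proj₁ (at-H nv p)) (≡-sym (proj₁ (at-H nv q)))
    at-hub (S s) nv (p , _) (q , _) = spoke-disjoint p q

    -- An oriented edge with its colour. An edge between two hubs is always a `fromHub`, since
    -- `toHub` asks for a nonhub start.
    data View (u v : Fin n) (c : Col) : Set where
      fromHub : ∀ k → u ≡ h k → At k v c → View u v c
      toHub   : ∀ k → NonHub u → v ≡ h k → At k u c → View u v c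
      rim     : Rim u v → c ≡ R (rc u v) → View u v c

    view-sym : ∀ {u v} c → View u v c → View v u c
    view-sym c     (toHub k nu p a) = fromHub k p a
    view-sym c     (rim r refl)     = rim (Rim-sym r) (cong R (rc-sym r))
    view-sym (R i) (fromHub k p a@(_ , nv , _))  = toHub k nv p a
    view-sym (S s) (fromHub k p a@((nv , _) , _)) = toHub k nv p a
    view-sym (H j) (fromHub k p (inj₁ (q , refl))) =
      fromHub (next k) q (inj₂ (inj₁ (trans p (cong h (≡-sym (prev-next k))) , ≡-sym (prev-next k))))
    view-sym (H j) (fromHub k p (inj₂ (inj₁ (q , r)))) =
      fromHub (prev k) q (inj₁ (trans p (cong h (≡-sym (next-prev k))) , r))
    view-sym (H j) (fromHub k p a@(inj₂ (inj₂ (_ , _ , nv , _)))) = toHub k nv p a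

    view-hub : ∀ {k v} c → View (h k) v c → At k v c
    view-hub {k} c (fromHub l p a) with h-inj p
    ... | refl = a
    view-hub {k} c (toHub l nu _ _) = contradiction refl (nu k)
    view-hub {k} c (rim (nu , _) _) = contradiction refl (nu k)

    view-rim : ∀ {u v} c → NonHub u → NonHub v → View u v c → Rim u v × c ≡ R (rc u v)
    view-rim c nu nv (fromHub k p _) = contradiction p (nu k)
    view-rim c nu nv (toHub k _ p _) = contradiction p (nv k)
    view-rim c nu nv (rim r p)       = r , p

    view-proper : ∀ {u v w} c → View u v c → View u w c → v ≢ w → ⊥
    view-proper c (fromHub k refl a) b v≢w = v≢w (at-unique c a (view-hub c b))
    view-proper c (toHub k nu p a) (fromHub l q _) v≢w = nu l q
    view-proper c (toHub k nu p a) (toHub l _ q b) v≢w =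
      v≢w (trans p (trans (cong h (at-hub c nu a b)) (≡-sym q)))
    -- A rim colour on a hub edge makes `u` a special vertex, whose rim edges avoid that colour.
    view-proper c (toHub k nu p a) (rim r refl) v≢w = rim-special (proj₂ a) r refl
    view-proper c (rim (nu , _) _) (fromHub l q _) v≢w = nu l q
    view-proper c (rim r refl) (toHub l _ q b) v≢w = rim-special (proj₂ b) r refl
    view-proper c (rim r refl) (rim r′ q) v≢w = rim-proper r r′ v≢w (R-injective q)

    -- Among edges to nonhubs, `H` colours go only to the special vertex of arc 2, from `h 2F`; and
    -- a spoke of `h (next i)` is not adjacent to `h i`. Only the rim colour is left.
    special-at-next : ∀ {i v} c → Special i v → At (next i) v c → c ≡ R i
    special-at-next {i} (R j) sv (p , _) = cong R (trans p (prev-next i))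
    special-at-next {i} (H j) sv@(nv , iv , _) a with at-H nv a
    ... | p , _ , s₂ =
      contradiction
        (trans (≡-sym p) (cong next (trans (≡-sym (special-arc sv)) (special-arc s₂)))) λ ()
    special-at-next {i} (S s) (_ , iv , _) (sv , _) = contradiction iv (spoke-next sv)

    at-H-hub : ∀ {k l j} → At k (h l) (H j) →
               (l ≡ next k × j ≡ k) ⊎ (l ≡ prev k × j ≡ prev k)
    at-H-hub (inj₁ (p , q))                  = inj₁ (h-inj p , q)
    at-H-hub (inj₂ (inj₁ (p , q)))           = inj₂ (h-inj p , q)
    at-H-hub (inj₂ (inj₂ (_ , _ , nh , _)))  = contradiction refl (nh _)

    at-H-index : ∀ {k v j} → At k v (H j) → j ≡ k ⊎ j ≡ prev k ⊎ (k ≡ 2F × j ≡ 0F)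
    at-H-index (inj₁ (_ , q))                = inj₁ q
    at-H-index (inj₂ (inj₁ (_ , q)))         = inj₂ (inj₁ q)
    at-H-index (inj₂ (inj₂ (p , q , _)))     = inj₂ (inj₂ (p , q))

    -- In the next five lemmas v₀ v₁ v₂ v₃ v₄ carries the colours α β α β; the names say which of
    -- v₁, v₂, v₃ are hubs. The remaining cases arise by reversing the walk.
    alt-hub-hub : ∀ {k l v₀ v₃ v₄} α β → h k ≢ v₃ →
             At k v₀ α → At k (h l) β → At l v₃ α → View v₃ v₄ β → ⊥
    alt-hub-hub α (R _) n a₁ (_ , nh , _) a₃ e₄ = nh _ refl
    alt-hub-hub α (S _) n a₁ ((nh , _) , _) a₃ e₄ = nh _ refl
    alt-hub-hub α (H j) n a₁ a₂ a₃ (rim _ ())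
    -- Here `v₃` is the special vertex of arc 2 and `β` is `H 0F`, so `h k` and `h l` are hubs 0 and
    -- 1. Hub 1 is not adjacent to `v₃`; the edge from hub 0 to `v₃` has colour `R 2F`, which does
    -- not occur at hub 1.
    alt-hub-hub {k} {l} α (H j) n a₁ a₂ a₃ e₄@(toHub m n₃ refl a₄) with at-H n₃ a₄
    ... | refl , refl , s₃ with at-H-hub {k} {l} a₂
    ...   | inj₁ (refl , refl) = special-third s₃ (at⇒adj α n₃ a₃)
    ...   | inj₂ (refl , p) with prev-injective {1F} {k} p
    ...     | refl with special-at-next α s₃ a₃
    ...       | refl = contradiction (proj₁ a₁) λ ()
    alt-hub-hub (R _) (H j) n a₁ a₂ (_ , nh , _)   (fromHub m refl a₄) = nh _ refl
    alt-hub-hub (S _) (H j) n a₁ a₂ ((nh , _) , _) (fromHub m refl a₄) = nh _ refl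
    alt-hub-hub {k} {l} (H i) (H j) n a₁ a₂ a₃ (fromHub m refl a₄) =
      triangle-tail k l m i j (at-H-hub {k} {l} a₂) (at-H-hub {l} {m} a₃)
        (n ∘ cong h) (at-H-index {k} a₁) (at-H-index {m} a₄)

    -- `v₂` is special on the arc between the two hubs. Its edge to the later end of that arc has a
    -- rim colour that does not occur at the earlier end.
    alt-hub-free-hub : ∀ {k l v₀ v₂ v₄} α β → k ≢ l → NonHub v₂ →
              At k v₀ α → At k v₂ β → At l v₂ α → At l v₄ β → ⊥
    alt-hub-free-hub α β k≢l n₂ a₁ a₂ a₃ a₄ with ≢⇒next k≢l
    alt-hub-free-hub {k} α β k≢l n₂ a₁ a₂ a₃ a₄ | inj₁ refl
      with special-at-next α (n₂ , at⇒adj β n₂ a₂ , at⇒adj α n₂ a₃) a₃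
    ... | refl = prev≢ k (≡-sym (proj₁ a₁))
    alt-hub-free-hub {l = l} α β k≢l n₂ a₁ a₂ a₃ a₄ | inj₂ refl
      with special-at-next β (n₂ , at⇒adj α n₂ a₃ , at⇒adj β n₂ a₂) a₂
    ... | refl = prev≢ l (≡-sym (proj₁ a₄))

    -- `w′` is a spoke of another hub `h l` and adjacent to `h k`, so it is special on an arc from
    -- `h l` to `h k`. As spokes of hub 2 avoid neighbours of hub 0, `l` is not 2 and `f-sep`
    -- applies.
    spoke-conflict : ∀ {k w w′ t s} → At k w (S s) → NonHub w′ → Adj G (h k) w′ →
                     View w′ t (S s) → t ≢ h k → ⊥
    spoke-conflict a nw′ kw′ (fromHub l p _) t≢ = nw′ l p
    spoke-conflict a nw′ kw′ (rim _ ()) t≢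
    spoke-conflict {k} (sw , p) nw′ kw′ (toHub l _ refl (sw′@(_ , lw′ , _ , ¬0w′) , q)) t≢
      with ≢⇒next {k} {l} (λ { refl → t≢ refl })
    ... | inj₁ refl = spoke-next sw′ kw′
    ... | inj₂ refl = f-sep (λ { refl → ¬0w′ refl kw′ }) (nw′ , lw′ , kw′) sw (trans (≡-sym q) p)

    view-H : ∀ {u v j} → NonHub u → View u v (H j) → v ≡ h 2F × Special 2F u
    view-H nu (fromHub k p _) = contradiction p (nu k)
    view-H nu (rim _ ())
    view-H nu (toHub k _ refl a) with at-H nu a
    ... | refl , _ , su = refl , su

    -- Spoke colours fall to `spoke-conflict`. Two rim colours, or two `H` colours, make `v₁` and
    -- `v₃` the same special vertex; in the mixed case the end edge of colour `H i` would lead back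
    -- to the hub.
    alt-free-hub-free : ∀ {k v₀ v₁ v₃ v₄} α β → NonHub v₁ → NonHub v₃ → v₀ ≢ h k → v₁ ≢ v₃ → v₄ ≢ h k →
              View v₁ v₀ α → At k v₁ β → At k v₃ α → View v₃ v₄ β → ⊥
    alt-free-hub-free (S s) β n₁ n₃ n₀₂ n₁₃ n₂₄ e₁ a₂ a₃ e₄ =
      spoke-conflict a₃ n₁ (at⇒adj β n₁ a₂) e₁ n₀₂
    alt-free-hub-free α (S s) n₁ n₃ n₀₂ n₁₃ n₂₄ e₁ a₂ a₃ e₄ =
      spoke-conflict a₂ n₃ (at⇒adj α n₃ a₃) e₄ n₂₄
    alt-free-hub-free (R i) (R j) n₁ n₃ n₀₂ n₁₃ n₂₄ e₁ (refl , s₁) (refl , s₃) e₄ = n₁₃ (special-unique s₁ s₃)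
    alt-free-hub-free (H i) β@(R _) n₁ n₃ n₀₂ n₁₃ n₂₄ e₁ a₂ a₃ e₄ with at-H n₃ a₃
    ... | refl , _ = n₀₂ (proj₁ (view-H n₁ e₁))
    alt-free-hub-free α@(R _) (H j) n₁ n₃ n₀₂ n₁₃ n₂₄ e₁ a₂ a₃ e₄ with at-H n₁ a₂
    ... | refl , _ = n₂₄ (proj₁ (view-H n₃ e₄))
    alt-free-hub-free (H i) (H j) n₁ n₃ n₀₂ n₁₃ n₂₄ e₁ a₂ a₃ e₄ =
      n₁₃ (special-unique (proj₂ (proj₂ (at-H n₁ a₂))) (proj₂ (proj₂ (at-H n₃ a₃))))

    -- `rim-path` forbids a rim edge from `u₁` to `u₀`, so `u₀` is a hub, and a rim colour on a hub
    -- edge means a special vertex.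
    rim-end : ∀ {u₀ u₁ u₂ u₃} → Rim u₁ u₂ → Rim u₂ u₃ → u₀ ≢ u₂ → u₁ ≢ u₃ →
              View u₁ u₀ (R (rc u₂ u₃)) → Special (arc u₂) u₁
    rim-end r₁ r₂ n₀ n₁ (fromHub k p _) = contradiction p (proj₁ r₁ k)
    rim-end {u₁ = u₁} r₁ r₂ n₀ n₁ (toHub k _ _ (_ , s₁)) =
      subst (λ i → Special i u₁) (trans (≡-sym (special-arc s₁)) (rim-same-arc r₁)) s₁
    rim-end r₁ r₂ n₀ n₁ (rim r p) =
      contradiction (trans (rc-sym (Rim-sym r)) (≡-sym (R-injective p)))
        (rim-path (Rim-sym r) r₁ r₂ n₀ n₁)

    -- `rim-end`, used from both sides, makes `v₁` and `v₃` special on the same arc.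
    alt-free-free-free : ∀ {v₀ v₁ v₂ v₃ v₄} α β → NonHub v₁ → NonHub v₂ → NonHub v₃ →
              v₀ ≢ v₂ → v₁ ≢ v₃ → v₂ ≢ v₄ →
              View v₁ v₀ α → View v₁ v₂ β → View v₂ v₃ α → View v₃ v₄ β → ⊥
    alt-free-free-free α β n₁ n₂ n₃ n₀₂ n₁₃ n₂₄ e₁ e₂ e₃ e₄ with view-rim β n₁ n₂ e₂ | view-rim α n₂ n₃ e₃
    ... | r₁ , refl | r₂ , refl = n₁₃ (special-unique
      (rim-end r₁ r₂ n₀₂ n₁₃ e₁)
      (rim-end (Rim-sym r₂) (Rim-sym r₁) (n₂₄ ∘ ≡-sym) (n₁₃ ∘ ≡-sym)
        (subst (λ c → View _ _ (R c)) (rc-sym r₁) e₄)))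

    -- `α` is a rim colour occurring at `h k`, hence `R (prev k)`. If `β` is a spoke colour, `v₂`
    -- and `v₃` are spokes of different hubs and `rim-cross` gives the edge between them another
    -- colour; otherwise two special vertices coincide.
    alt-hub-free-free : ∀ {k v₀ v₂ v₃ v₄} α β → NonHub v₂ → NonHub v₃ → v₀ ≢ v₂ → h k ≢ v₄ →
              At k v₀ α → At k v₂ β → View v₂ v₃ α → View v₃ v₄ β → ⊥
    alt-hub-free-free {k} α β n₂ n₃ n₀₂ n₁₄ a₁ a₂ e₃ e₄ with view-rim α n₂ n₃ e₃
    alt-hub-free-free {k} α (R i) n₂ n₃ n₀₂ n₁₄ (p , s₀) (refl , s₂) e₃ e₄ | r , refl =
      n₀₂ (special-unique (subst (λ i → Special i _) p s₀) s₂)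
    alt-hub-free-free {k} α (H j) n₂ n₃ n₀₂ n₁₄ a₁ a₂ e₃ e₄ | (_ , _ , uv) , refl =
      Adj-irrefl G uv (special-unique (proj₂ (proj₂ (at-H n₂ a₂))) (proj₂ (view-H n₃ e₄)))
    alt-hub-free-free {k} α (S s) n₂ n₃ n₀₂ n₁₄ a₁ a₂ e₃ (fromHub l p _) | r , refl = n₃ l p
    alt-hub-free-free {k} α (S s) n₂ n₃ n₀₂ n₁₄ a₁ a₂ e₃ (rim _ ()) | r , refl
    alt-hub-free-free {k} α (S s) n₂ n₃ n₀₂ n₁₄ (p , _) (s₂ , _) e₃ (toHub l _ refl (s₃ , _)) | r , refl
      with ≢⇒next {k} {l} (n₁₄ ∘ cong h)
    ... | inj₁ refl = prev≢next k (trans (≡-sym p) (rim-cross s₂ s₃ r))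
    ... | inj₂ refl = prev≢ k (trans (≡-sym p) (trans (rc-sym r) (rim-cross s₃ s₂ (Rim-sym r))))

    -- `v₀` and `v₄` may be equal, so that cycles are covered along with paths.
    not-alternating : ∀ {v₀ v₁ v₂ v₃ v₄} α β →
      v₀ ≢ v₂ → v₁ ≢ v₃ → v₂ ≢ v₄ → v₁ ≢ v₄ → v₀ ≢ v₃ →
      View v₀ v₁ α → View v₁ v₂ β → View v₂ v₃ α → View v₃ v₄ β → ⊥
    not-alternating {v₁ = v₁} {v₂} {v₃} α β n₀₂ n₁₃ n₂₄ n₁₄ n₀₃ e₁ e₂ e₃ e₄
      with hub? v₁ | hub? v₂ | hub? v₃
    ... | inj₁ (k , refl) | inj₁ (l , refl) | _ = alt-hub-hub {k} {l} α β n₁₃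
      (view-hub α (view-sym α e₁)) (view-hub β e₂) (view-hub α e₃) e₄
    ... | _ | inj₁ (l , refl) | inj₁ (m , refl) = alt-hub-hub {m} {l} β α (n₁₃ ∘ ≡-sym)
      (view-hub β e₄) (view-hub α (view-sym α e₃)) (view-hub β (view-sym β e₂)) (view-sym α e₁)
    ... | inj₁ (k , refl) | inj₂ n₂ | inj₁ (m , refl) = alt-hub-free-hub α β (n₁₃ ∘ cong h) n₂
      (view-hub α (view-sym α e₁)) (view-hub β e₂) (view-hub α (view-sym α e₃)) (view-hub β e₄)
    ... | inj₂ n₁ | inj₁ (l , refl) | inj₂ n₃ = alt-free-hub-free α β n₁ n₃ n₀₂ n₁₃ (n₂₄ ∘ ≡-sym)
      (view-sym α e₁) (view-hub β (view-sym β e₂)) (view-hub α e₃) e₄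
    ... | inj₂ n₁ | inj₂ n₂ | inj₂ n₃ = alt-free-free-free α β n₁ n₂ n₃ n₀₂ n₁₃ n₂₄ (view-sym α e₁) e₂ e₃ e₄
    ... | inj₁ (k , refl) | inj₂ n₂ | inj₂ n₃ = alt-hub-free-free α β n₂ n₃ n₀₂ n₁₄
      (view-hub α (view-sym α e₁)) (view-hub β e₂) e₃ e₄
    ... | inj₂ n₁ | inj₂ n₂ | inj₁ (m , refl) = alt-hub-free-free β α n₂ n₁ (n₂₄ ∘ ≡-sym) (n₀₃ ∘ ≡-sym)
      (view-hub β e₄) (view-hub α (view-sym α e₃)) (view-sym β e₂) (view-sym α e₁)

    hubColour : Fin 3 → Fin 3 → Col
    hubColour k l with l ≟ᶠ next k
    ... | yes _ = H k
    ... | no  _ = H l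

    spokeColour : Fin 3 → Fin n → Col
    spokeColour k v with Adj? G (h (prev k)) v
    ... | yes _ = R (prev k)
    ... | no  _ with k ≟ᶠ 2F ×-dec Adj? G (h 0F) v
    ...   | yes _ = H 0F
    ...   | no  _ = S (f k v)

    colour : Fin n → Fin n → Col
    colour u v with hub? u | hub? v
    ... | inj₁ (k , _) | inj₁ (l , _) = hubColour k l
    ... | inj₁ (k , _) | inj₂ _       = spokeColour k v
    ... | inj₂ _       | inj₁ (l , _) = spokeColour l u
    ... | inj₂ _       | inj₂ _       = R (rc u v)

    hub-at : ∀ {k l} → k ≢ l → At k (h l) (hubColour k l)
    hub-at {k} {l} k≢l with l ≟ᶠ next k
    ... | yes p = inj₁ (cong h p , refl)
    ... | no ¬p with ≢⇒next k≢l
    ...   | inj₁ q    = contradiction q ¬p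
    ...   | inj₂ refl = inj₂ (inj₁ (cong h (≡-sym (prev-next l)) , ≡-sym (prev-next l)))

    spoke-at : ∀ {k v} → NonHub v → Adj G (h k) v → At k v (spokeColour k v)
    spoke-at {k} {v} nv kv with Adj? G (h (prev k)) v
    ... | yes pv = refl , nv , pv , subst (λ j → Adj G (h j) v) (≡-sym (next-prev k)) kv
    ... | no ¬pv with k ≟ᶠ 2F ×-dec Adj? G (h 0F) v
    ...   | yes (refl , 0v) = inj₂ (inj₂ (refl , refl , nv , kv , 0v))
    ...   | no ¬0v = (nv , kv , ¬pv , λ k≡2 0v → ¬0v (k≡2 , 0v)) , refl

    colour-view : ∀ u v → Adj G u v → View u v (colour u v)
    colour-view u v uv with hub? u | hub? v
    ... | inj₁ (k , refl) | inj₁ (l , refl) = fromHub k refl (hub-at (Adj-irrefl G uv ∘ cong h))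
    ... | inj₁ (k , refl) | inj₂ nv         = fromHub k refl (spoke-at nv uv)
    ... | inj₂ nu         | inj₁ (l , refl) = toHub l nu refl (spoke-at nu (Adj-sym G uv))
    ... | inj₂ nu         | inj₂ nv         = rim (nu , nv , uv) refl

    hubColour-sym : ∀ {k l} → k ≢ l → hubColour k l ≡ hubColour l k
    hubColour-sym {k} {l} k≢l with l ≟ᶠ next k | k ≟ᶠ next l
    ... | yes refl | yes q =
      contradiction (trans (cong prev q) (prev-next (next k))) (prev≢next k)
    ... | yes _ | no _  = refl
    ... | no _  | yes _ = refl
    ... | no ¬p | no ¬q with ≢⇒next k≢l
    ...   | inj₁ p = contradiction p ¬p
    ...   | inj₂ q = contradiction q ¬q

    colour-sym : ∀ u v → Adj G u v → colour u v ≡ colour v u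
    colour-sym u v uv with hub? u | hub? v
    ... | inj₁ (k , refl) | inj₁ (l , refl) = hubColour-sym (Adj-irrefl G uv ∘ cong h)
    ... | inj₁ (k , refl) | inj₂ nv         = refl
    ... | inj₂ nu         | inj₁ (l , refl) = refl
    ... | inj₂ nu         | inj₂ nv         = cong R (rc-sym (nu , nv , uv))

    code-< : ∀ {u v m} c → (∀ {k v} → Spoke k v → f k v < m) → View u v c → code c < 6 + m
    code-< (R i) f< e = ℕₚ.<-≤-trans (Finₚ.toℕ<n i) (ℕₚ.m≤m+n 3 _)
    code-< (H i) f< e = ℕₚ.+-monoʳ-< 3 (ℕₚ.<-≤-trans (Finₚ.toℕ<n i) (ℕₚ.m≤m+n 3 _))
    code-< (S s) f< (fromHub k _ (sv , refl)) = ℕₚ.+-monoʳ-< 6 (f< sv)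
    code-< (S s) f< (toHub k _ _ (sv , refl)) = ℕₚ.+-monoʳ-< 6 (f< sv)

    module _ {m} (f< : ∀ {k v} → Spoke k v → f k v < m) where

      col : Fin n → Fin n → Fin (6 + m)
      col u v = clamp (5 + m) (code (colour u v))

      col-injective : ∀ {u v w x} → Adj G u v → Adj G w x → col u v ≡ col w x →
                      colour u v ≡ colour w x
      col-injective {u} {v} {w} {x} uv wx eq = code-injective (clamp-injective
        (code-< (colour u v) f< (colour-view u v uv))
        (code-< (colour w x) f< (colour-view w x wx)) eq)

      col-sym : ∀ u v → Adj G u v → col u v ≡ col v u
      col-sym u v uv = cong (clamp (5 + m) ∘ code) (colour-sym u v uv)

      col-proper : ∀ u v w → Adj G u v → Adj G u w → v ≢ w → col u v ≢ col u w
      col-proper u v w uv uw v≢w eq = view-proper (colour u v) (colour-view u v uv)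
        (subst (View u w) (≡-sym (col-injective uv uw eq)) (colour-view u w uw)) v≢w

      col-proper′ : ∀ {u v w} → Adj G u v → Adj G v w → u ≢ w → col u v ≢ col v w
      col-proper′ {u} {v} {w} uv vw u≢w eq =
        col-proper v u w (Adj-sym G uv) vw u≢w (trans (≡-sym (col-sym u v uv)) eq)

      no-bichromatic : ∀ {v₀ v₁ v₂ v₃ v₄} →
        v₀ ≢ v₂ → v₁ ≢ v₃ → v₂ ≢ v₄ → v₁ ≢ v₄ → v₀ ≢ v₃ →
        Adj G v₀ v₁ → Adj G v₁ v₂ → Adj G v₂ v₃ → Adj G v₃ v₄ →
        ¬ TwoColoured (col v₀ v₁) (col v₁ v₂) (col v₂ v₃) (col v₃ v₄)
      no-bichromatic {v₀} {v₁} {v₂} {v₃} {v₄} n₀₂ n₁₃ n₂₄ n₁₄ n₀₃ e₁ e₂ e₃ e₄ tc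
        with two-colours-alternate tc
               (col-proper′ e₁ e₂ n₀₂) (col-proper′ e₂ e₃ n₁₃) (col-proper′ e₃ e₄ n₂₄)
      ... | p , q = not-alternating (colour v₀ v₁) (colour v₁ v₂) n₀₂ n₁₃ n₂₄ n₁₄ n₀₃
        (colour-view v₀ v₁ e₁) (colour-view v₁ v₂ e₂)
        (subst (View v₂ v₃) (≡-sym (col-injective e₁ e₃ p)) (colour-view v₂ v₃ e₃))
        (subst (View v₃ v₄) (≡-sym (col-injective e₂ e₄ q)) (colour-view v₃ v₄ e₄))

      starColouring : StarEdgeColouring G (6 + m)
      starColouring = record
        { col    = col
        ; symm   = col-sym
        ; proper = col-proper
        ; noBichromaticPath = λ where
            v₀ v₁ v₂ v₃ v₄ (((_ ∷ n₀₂ ∷ n₀₃ ∷ _) ∷ (_ ∷ n₁₃ ∷ n₁₄ ∷ _) ∷ (_ ∷ n₂₄ ∷ _) ∷ _) ,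
                            e₁ , e₂ , e₃ , e₄) →
              no-bichromatic n₀₂ n₁₃ n₂₄ n₁₄ n₀₃ e₁ e₂ e₃ e₄
        ; noBichromaticCycle = λ where
            v₀ v₁ v₂ v₃ (((n₀₁ ∷ n₀₂ ∷ n₀₃ ∷ _) ∷ (_ ∷ n₁₃ ∷ _) ∷ _) , e₁ , e₂ , e₃ , e₄) →
              no-bichromatic n₀₂ n₁₃ (n₀₂ ∘ ≡-sym) (n₀₁ ∘ ≡-sym) n₀₃ e₁ e₂ e₃ e₄
        }

  -- Choosing the numbering of the spokes

  module _ {m} (spokes≤ : ∀ k → length (spokes k) ≤ m)
               (spokes< : ∀ {k v} → k ≢ 2F → Special k v → length (spokes (next k)) < m)
               where

    recolour : Fin 3 → ℕ → ℕ → ℕ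
    recolour i t with Finₚ.any? (Special? i)
    ... | yes (x , _) = swap (rank (spokes i) x) t
    ... | no  _       = id

    recolour-special : ∀ {i t x} → Special i x → recolour i t (rank (spokes i) x) ≡ t
    recolour-special {i} {t} {x} sx with Finₚ.any? (Special? i)
    ... | yes (y , sy) rewrite special-unique sx sy = swap-left (rank (spokes i) y) t
    ... | no ¬s = contradiction (x , sx) ¬s

    recolour-injective : ∀ {i t r s} → recolour i t r ≡ recolour i t s → r ≡ s
    recolour-injective {i} {t} eq with Finₚ.any? (Special? i)
    ... | yes (y , _) = swap-injective (rank (spokes i) y) t eq
    ... | no _ = eq

    recolour-< : ∀ {i t r} → i ≢ 2F → (∀ {x} → Special i x → t < m) → r < m →
                 recolour i t r < m
    recolour-< {i} i≢2 t< r< with Finₚ.any? (Special? i)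
    ... | yes (y , sy) = swap-<
      (ℕₚ.<-≤-trans (rank-< (∈-spokes (special⇒spoke i≢2 sy))) (spokes≤ i)) (t< sy) r<
    ... | no _ = r<

    -- The spokes of hub l have the colours shift l r with r below their number, so shift l of that
    -- number itself is unused there; for l = next k it goes to the edge from h k to the special
    -- vertex of arc k.
    shift : Fin 3 → ℕ → ℕ
    shift 2F = id
    shift 1F = recolour 1F (length (spokes 2F))
    shift 0F = recolour 0F (shift 1F (length (spokes 1F)))

    spokeIndex : Fin 3 → Fin n → ℕ
    spokeIndex k v = shift k (rank (spokes k) v)

    shift-injective : ∀ k {r s} → shift k r ≡ shift k s → r ≡ s
    shift-injective 0F = recolour-injective
    shift-injective 1F = recolour-injective
    shift-injective 2F = id

    shift-< : ∀ k {r} → r < m → shift k r < m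
    shift-< 0F = recolour-< (λ ()) λ sx → shift-< 1F (spokes< (λ ()) sx)
    shift-< 1F = recolour-< (λ ()) (spokes< (λ ()))
    shift-< 2F = id

    spokeIndex-injective : ∀ {k u v} → Spoke k u → Spoke k v →
                           spokeIndex k u ≡ spokeIndex k v → u ≡ v
    spokeIndex-injective {k} su sv eq =
      rank-injective (∈-spokes su) (∈-spokes sv) (shift-injective k eq)

    spokeIndex-< : ∀ {k v} → Spoke k v → spokeIndex k v < m
    spokeIndex-< {k} sv = shift-< k (ℕₚ.<-≤-trans (rank-< (∈-spokes sv)) (spokes≤ k))

    spokeIndex-special : ∀ k {u} → k ≢ 2F → Special k u →
                         spokeIndex k u ≡ shift (next k) (length (spokes (next k)))
    spokeIndex-special 0F _   su = recolour-special su
    spokeIndex-special 1F _   su = recolour-special su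
    spokeIndex-special 2F k≢2 _  = contradiction refl k≢2

    -- The numberings are fixed in the order hub 2, hub 1, hub 0, each relative to the one before.
    -- This chain cannot be closed up cyclically, which is why the special edge at `h 2F` has the
    -- colour `H 0F` instead.
    spokeIndex-separated : ∀ {k u v} → k ≢ 2F → Special k u → Spoke (next k) v →
                           spokeIndex k u ≢ spokeIndex (next k) v
    spokeIndex-separated {k} k≢2 su sv eq = ℕₚ.<⇒≢ (rank-< (∈-spokes sv))
      (≡-sym (shift-injective (next k) (trans (≡-sym (spokeIndex-special k k≢2 su)) eq)))

    frameColouring : StarEdgeColouring G (6 + m)
    frameColouring = starColouring spokeIndex spokeIndex-injective spokeIndex-separated spokeIndex-<

-- Finding the hubs

NonCrossing : ∀ {n} → Graph n → (Fin n → ℕ) → Set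
NonCrossing G p = ∀ {u v w x} → Adj G u v → Adj G w x → p u < p w → p w < p v → ¬ p v < p x

-- Uncrossed chords and dominated sides

module Chords {n} {G : Graph n} (p : Fin n → ℕ)
  (p-inj : ∀ {u v} → p u ≡ p v → u ≡ v)
  (p<n : ∀ v → p v < n)
  (p-surj : ∀ {i} → i < n → ∃ λ v → p v ≡ i)
  (nc : NonCrossing G p)
  where

  Inside Outside Dominated : Fin n → Fin n → Fin n → Set
  Inside u v w = p u < p w × p w < p v
  Outside u v w = p w < p u ⊎ p v < p w
  Dominated u v w = Adj G u w ⊎ Adj G v w

  Inside? : ∀ u v w → Dec (Inside u v w)
  Inside? u v w = p u <? p w ×-dec p w <? p v

  Dominated? : ∀ u v w → Dec (Dominated u v w)
  Dominated? u v w = Adj? G u w ⊎-dec Adj? G v w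

  -- No edge crosses the chord from `u` to `v`, which need not be an edge itself.
  Chord : Fin n → Fin n → Set
  Chord u v = ∀ {s t} → Inside u v s → Outside u v t → ¬ Adj G s t

  locate : ∀ u v w → w ≡ u ⊎ w ≡ v ⊎ Inside u v w ⊎ Outside u v w
  locate u v w with ℕₚ.<-cmp (p w) (p u) | ℕₚ.<-cmp (p w) (p v)
  ... | tri≈ _ eq _ | _           = inj₁ (p-inj eq)
  ... | tri< lt _ _ | _           = inj₂ (inj₂ (inj₂ (inj₁ lt)))
  ... | tri> _ _ _  | tri≈ _ eq _ = inj₂ (inj₁ (p-inj eq))
  ... | tri> _ _ gt | tri< lt _ _ = inj₂ (inj₂ (inj₁ (gt , lt)))
  ... | tri> _ _ _  | tri> _ _ gt = inj₂ (inj₂ (inj₂ (inj₂ gt)))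

  inside-outside : ∀ {u v w} → Inside u v w → ¬ Outside u v w
  inside-outside (u<w , w<v) (inj₁ w<u) = ℕₚ.<-asym u<w w<u
  inside-outside (u<w , w<v) (inj₂ v<w) = ℕₚ.<-asym w<v v<w

  stay-inside : ∀ {u v s w} → Chord u v → Inside u v s → ¬ Dominated u v s → Adj G s w →
                Inside u v w
  stay-inside {u} {v} {s} {w} chord ins ¬dom sw with locate u v w
  ... | inj₁ refl               = contradiction (inj₁ (Adj-sym G sw)) ¬dom
  ... | inj₂ (inj₁ refl)        = contradiction (inj₂ (Adj-sym G sw)) ¬dom
  ... | inj₂ (inj₂ (inj₁ ins′)) = ins′
  ... | inj₂ (inj₂ (inj₂ out))  = contradiction sw (chord ins out)

  stay-outside : ∀ {u v t w} → Chord u v → Outside u v t → ¬ Dominated u v t → Adj G w t →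
                 Outside u v w
  stay-outside {u} {v} {t} {w} chord out ¬dom wt with locate u v w
  ... | inj₁ refl               = contradiction (inj₁ wt) ¬dom
  ... | inj₂ (inj₁ refl)        = contradiction (inj₂ wt) ¬dom
  ... | inj₂ (inj₂ (inj₁ ins))  = contradiction wt (chord ins out)
  ... | inj₂ (inj₂ (inj₂ out′)) = out′

  -- `w` is the last vertex inside that directly follows `u` or is adjacent to `u`. An edge leaving
  -- the piece between `w` and `v` would cross the chord `uv` or the edge `uw`, or end at `u`
  -- against the choice of `w`.
  apex : ∀ {u v x} → Chord u v → Inside u v x →
         ∃ λ w → Inside u v w × Chord u w × Chord w v
  apex {u} {v} {x} chord (u<x , x<v) = w , w-in , chord₁ , chord₂
    where
    Candidate : Fin n → Set
    Candidate w = Inside u v w × (p w ≡ suc (p u) ⊎ Adj G u w)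
    successor = p-surj (ℕₚ.≤-<-trans u<x (p<n x))
    maximum : ∃ λ w → Candidate w × (∀ y → Candidate y → p y ≤ p w)
    maximum = argmax p
      (λ w → Inside? u v w ×-dec (p w ≟ suc (p u) ⊎-dec Adj? G u w))
      {proj₁ successor}
      (subst (λ i → p u < i × i < p v) (≡-sym (proj₂ successor))
         (ℕₚ.n<1+n _ , ℕₚ.≤-<-trans u<x x<v) ,
       inj₁ (proj₂ successor))
    w = proj₁ maximum
    w-in = proj₁ (proj₁ (proj₂ maximum))
    w-max = proj₂ (proj₂ maximum)
    edge : ∀ {s} → Inside u w s → Adj G u w
    edge (u<s , s<w) with proj₂ (proj₁ (proj₂ maximum))
    ... | inj₁ eq = contradiction (subst (p _ <_) eq s<w) (ℕₚ.≤⇒≯ u<s)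
    ... | inj₂ uw = uw
    chord₁ : Chord u w
    chord₁ ins@(u<s , s<w) (inj₁ t<u) st = nc (Adj-sym G st) (edge ins) t<u u<s s<w
    chord₁ ins@(u<s , s<w) (inj₂ w<t) st = nc (edge ins) st u<s s<w w<t
    chord₂ : Chord w v
    chord₂ (w<s , s<v) (inj₂ v<t) st = chord (ℕₚ.<-trans (proj₁ w-in) w<s , s<v) (inj₂ v<t) st
    chord₂ {s} {t} (w<s , s<v) (inj₁ t<w) st with ℕₚ.<-cmp (p t) (p u)
    ... | tri< t<u _ _ = chord (ℕₚ.<-trans (proj₁ w-in) w<s , s<v) (inj₁ t<u) st
    ... | tri> _ _ u<t = nc (edge (u<t , t<w)) (Adj-sym G st) u<t t<w w<s
    ... | tri≈ _ t≡u _ with p-inj t≡u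
    ...   | refl = ℕₚ.<⇒≱ w<s
      (w-max s ((ℕₚ.<-trans (proj₁ w-in) w<s , s<v) , inj₂ (Adj-sym G st)))

  record Hubs : Set where
    field
      a b c    : Fin n
      a<b      : p a < p b
      b<c      : p b < p c
      chord-ab : Chord a b
      chord-bc : Chord b c
      chord-ac : Chord a c
      dom-ab   : ∀ {s} → Inside a b s → Dominated a b s
      dom-bc   : ∀ {s} → Inside b c s → Dominated b c s
      dom-ac   : ∀ {s} → Outside a c s → Dominated a c s

  module _ (close : ∀ u v → ∃ λ k → Walk G u v k × k ≤ 3) where

    -- If `t` were undominated too, a walk from `s` to `t` would stay inside on its first step and
    -- already be outside before its last, so with at most three edges one of them would cross the
    -- chord.
    one-side-dominated : ∀ {u v s t} → Chord u v → Inside u v s → ¬ Dominated u v s →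
                         Outside u v t → Dominated u v t
    one-side-dominated {u} {v} {s} {t} chord ins ¬s out =
      decidable-stable (Dominated? u v t) λ ¬t → walk ¬t (close s t)
      where
      walk : ¬ Dominated u v t → ¬ (∃ λ k → Walk G s t k × k ≤ 3)
      walk ¬t (_ , here , _) = inside-outside ins out
      walk ¬t (_ , step e _ here , _) = chord ins out e
      walk ¬t (_ , step e₁ _ (step e₂ _ here) , _) = chord (stay-inside chord ins ¬s e₁) out e₂
      walk ¬t (_ , step e₁ _ (step e₂ _ (step e₃ _ here)) , _) =
        chord (stay-inside chord ins ¬s e₁) (stay-outside chord out ¬t e₃) e₂
      walk ¬t (_ , step _ _ (step _ _ (step _ _ (step _ _ _))) , s≤s (s≤s (s≤s ())))

    -- The apex splits the inside into two pieces. If one piece contains a vertex its ends do not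
    -- dominate, everything beyond its chord is dominated and the search continues with that shorter
    -- chord; otherwise `u`, `w`, `v` are the hubs.
    search : ∀ fuel {u v x} → p v ≤ fuel + p u → Chord u v → Inside u v x →
             (∀ {t} → Outside u v t → Dominated u v t) → Hubs
    search zero {u} {v} v≤u chord (u<x , x<v) _ =
      contradiction (ℕₚ.<-trans u<x x<v) (ℕₚ.≤⇒≯ v≤u)
    search (suc fuel) {u} {v} v≤ chord x-in dom with apex chord x-in
    ... | w , (u<w , w<v) , chord₁ , chord₂
      with Finₚ.any? (λ s → Inside? u w s ×-dec ¬? (Dominated? u w s))
         | Finₚ.any? (λ s → Inside? w v s ×-dec ¬? (Dominated? w v s))
    ... | yes (s , s-in , ¬s) | _ = search fuel (ℕₚ.≤-pred (ℕₚ.≤-trans w<v v≤)) chord₁ s-in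
      (one-side-dominated chord₁ s-in ¬s)
    ... | no _ | yes (s , s-in , ¬s) = search fuel
      (ℕₚ.≤-trans v≤ (subst (_≤ fuel + p w) (ℕₚ.+-suc fuel (p u)) (ℕₚ.+-monoʳ-≤ fuel u<w)))
      chord₂ s-in (one-side-dominated chord₂ s-in ¬s)
    ... | no none₁ | no none₂ = record
      { a = u ; b = w ; c = v ; a<b = u<w ; b<c = w<v
      ; chord-ab = chord₁ ; chord-bc = chord₂ ; chord-ac = chord
      ; dom-ab = λ {s} ins → decidable-stable (Dominated? u w s) λ ¬s → none₁ (s , ins , ¬s)
      ; dom-bc = λ {s} ins → decidable-stable (Dominated? w v s) λ ¬s → none₂ (s , ins , ¬s)
      ; dom-ac = dom
      }

    hubs : 2 < n → Hubs
    -- The first chord joins positions 0 and `2 + m`, the last one as `n` is `3 + m`: no vertex is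
    -- outside, and position 1 is inside.
    hubs (s≤s (s≤s (s≤s {n = m} z≤n))) = search (2 + m) last≤ (λ _ → ⊥-elim ∘ no-outside)
      (subst₂ _<_ (≡-sym p-first) (≡-sym p-second) (s≤s z≤n) ,
       subst₂ _<_ (≡-sym p-second) (≡-sym p-last) (s≤s (s≤s z≤n)))
      (⊥-elim ∘ no-outside)
      where
      first  = p-surj {0} (s≤s z≤n)
      second = p-surj {1} (s≤s (s≤s z≤n))
      last   = p-surj {2 + m} ℕₚ.≤-refl
      p-first  = proj₂ first
      p-second = proj₂ second
      p-last   = proj₂ last
      last≤ : p (proj₁ last) ≤ 2 + m + p (proj₁ first)
      last≤ = subst (_≤ 2 + m + p (proj₁ first)) (≡-sym p-last) (ℕₚ.m≤m+n _ _)
      no-outside : ∀ {t} → ¬ Outside (proj₁ first) (proj₁ last) t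
      no-outside {t} (inj₁ lt) = contradiction (subst (p t <_) p-first lt) λ ()
      no-outside {t} (inj₂ lt) = ℕₚ.<⇒≱ (p<n t) (subst (λ i → suc i ≤ p t) p-last lt)

  -- The frame given by three hubs

  module _ (H : Hubs) where
    open Hubs H

    -- The circle is cut open just before a, so that the arc from c to a becomes an interval.
    κ : Fin n → ℕ
    κ t with p t <? p a
    ... | yes _ = p t + n
    ... | no  _ = p t

    κ-cases : ∀ t → (p t < p a × κ t ≡ p t + n) ⊎ (p a ≤ p t × κ t ≡ p t)
    κ-cases t with p t <? p a
    ... | yes lt = inj₁ (lt , refl)
    ... | no ¬lt = inj₂ (ℕₚ.≮⇒≥ ¬lt , refl)

    κ-unwrapped : ∀ {t} → p a ≤ p t → κ t ≡ p t
    κ-unwrapped {t} a≤t with κ-cases t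
    ... | inj₁ (t<a , _) = contradiction t<a (ℕₚ.≤⇒≯ a≤t)
    ... | inj₂ (_ , eq)  = eq

    κ-wrapped : ∀ {t} → p t < p a → κ t ≡ p t + n
    κ-wrapped {t} t<a with κ-cases t
    ... | inj₁ (_ , eq)  = eq
    ... | inj₂ (a≤t , _) = contradiction t<a (ℕₚ.≤⇒≯ a≤t)

    n≰p : ∀ {u v} → p u ≡ p v + n → ⊥
    n≰p {u} {v} eq = ℕₚ.<⇒≱ (p<n u) (subst (n ≤_) (≡-sym eq) (ℕₚ.m≤n+m n (p v)))

    κ-inj : ∀ {u v} → κ u ≡ κ v → u ≡ v
    κ-inj {u} {v} eq with κ-cases u | κ-cases v
    ... | inj₁ (_ , p₁) | inj₁ (_ , p₂) =
      p-inj (ℕₚ.+-cancelʳ-≡ n _ _ (trans (≡-sym p₁) (trans eq p₂)))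
    ... | inj₁ (_ , p₁) | inj₂ (_ , p₂) = ⊥-elim (n≰p {v} {u} (trans (≡-sym p₂) (trans (≡-sym eq) p₁)))
    ... | inj₂ (_ , p₁) | inj₁ (_ , p₂) = ⊥-elim (n≰p {u} {v} (trans (≡-sym p₁) (trans eq p₂)))
    ... | inj₂ (_ , p₁) | inj₂ (_ , p₂) = p-inj (trans (≡-sym p₁) (trans eq p₂))

    data Order (u v : Fin n) : Set where
      both-unwrapped : p a ≤ p u → p a ≤ p v → p u < p v → Order u v
      wraps          : p a ≤ p u → p v < p a → Order u v
      both-wrapped   : p u < p a → p v < p a → p u < p v → Order u v

    order : ∀ {u v} → κ u < κ v → Order u v
    order {u} {v} lt with κ-cases u | κ-cases v
    ... | inj₁ (q₁ , p₁) | inj₁ (q₂ , p₂) =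
      both-wrapped q₁ q₂ (ℕₚ.+-cancelʳ-< n _ _ (subst₂ _<_ p₁ p₂ lt))
    ... | inj₁ (q₁ , p₁) | inj₂ (q₂ , p₂) = contradiction (subst₂ _<_ p₁ p₂ lt)
      (ℕₚ.≤⇒≯ (ℕₚ.≤-trans (ℕₚ.<⇒≤ (p<n v)) (ℕₚ.m≤n+m n (p u))))
    ... | inj₂ (q₁ , p₁) | inj₁ (q₂ , p₂) = wraps q₁ q₂
    ... | inj₂ (q₁ , p₁) | inj₂ (q₂ , p₂) = both-unwrapped q₁ q₂ (subst₂ _<_ p₁ p₂ lt)

    -- Crossing depends only on the cyclic order: at most one of the three steps passes the cut, and
    -- a rotation brings the four ends into increasing order of `p`.
    κ-nc : NonCrossing G κ
    κ-nc {u} {v} {w} {x} uv wx u<w w<v v<x with order u<w | order w<v | order v<x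
    ... | both-unwrapped _ _ l₁ | both-unwrapped _ _ l₂ | both-unwrapped _ _ l₃ = nc uv wx l₁ l₂ l₃
    ... | both-unwrapped a≤u _ l₁ | both-unwrapped _ _ l₂ | wraps _ x<a =
      nc (Adj-sym G wx) uv (ℕₚ.<-≤-trans x<a a≤u) l₁ l₂
    ... | both-unwrapped a≤u _ l₁ | wraps _ _ | both-wrapped _ x<a l₃ =
      nc (Adj-sym G uv) (Adj-sym G wx) l₃ (ℕₚ.<-≤-trans x<a a≤u) l₁
    ... | wraps a≤u _ | both-wrapped _ _ l₂ | both-wrapped _ x<a l₃ =
      nc wx (Adj-sym G uv) l₂ l₃ (ℕₚ.<-≤-trans x<a a≤u)
    ... | both-wrapped _ _ l₁ | both-wrapped _ _ l₂ | both-wrapped _ _ l₃ = nc uv wx l₁ l₂ l₃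
    ... | both-unwrapped _ a≤w _ | both-wrapped w<a _ _ | _ = contradiction w<a (ℕₚ.≤⇒≯ a≤w)
    ... | wraps _ w<a | both-unwrapped a≤w _ _ | _ = contradiction w<a (ℕₚ.≤⇒≯ a≤w)
    ... | wraps _ w<a | wraps a≤w _ | _ = contradiction w<a (ℕₚ.≤⇒≯ a≤w)
    ... | both-wrapped _ w<a _ | both-unwrapped a≤w _ _ | _ = contradiction w<a (ℕₚ.≤⇒≯ a≤w)
    ... | both-wrapped _ w<a _ | wraps a≤w _ | _ = contradiction w<a (ℕₚ.≤⇒≯ a≤w)
    ... | _ | both-unwrapped _ a≤v _ | both-wrapped v<a _ _ = contradiction v<a (ℕₚ.≤⇒≯ a≤v)
    ... | _ | wraps _ v<a | both-unwrapped a≤v _ _ = contradiction v<a (ℕₚ.≤⇒≯ a≤v)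
    ... | _ | wraps _ v<a | wraps a≤v _ = contradiction v<a (ℕₚ.≤⇒≯ a≤v)
    ... | _ | both-wrapped _ v<a _ | both-unwrapped a≤v _ _ = contradiction v<a (ℕₚ.≤⇒≯ a≤v)
    ... | _ | both-wrapped _ v<a _ | wraps a≤v _ = contradiction v<a (ℕₚ.≤⇒≯ a≤v)

    a<c : p a < p c
    a<c = ℕₚ.<-trans a<b b<c

    κa : κ a ≡ p a
    κa = κ-unwrapped ℕₚ.≤-refl
    κb : κ b ≡ p b
    κb = κ-unwrapped (ℕₚ.<⇒≤ a<b)
    κc : κ c ≡ p c
    κc = κ-unwrapped (ℕₚ.<⇒≤ a<c)

    a≤κ : ∀ t → p a ≤ κ t
    a≤κ t with κ-cases t
    ... | inj₁ (_ , eq)   = subst (p a ≤_) (≡-sym eq)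
      (ℕₚ.≤-trans (ℕₚ.<⇒≤ (p<n a)) (ℕₚ.m≤n+m n (p t)))
    ... | inj₂ (a≤t , eq) = subst (p a ≤_) (≡-sym eq) a≤t

    κ<a+n : ∀ t → κ t < p a + n
    κ<a+n t with κ-cases t
    ... | inj₁ (t<a , eq) = subst (_< p a + n) (≡-sym eq) (ℕₚ.+-monoˡ-< n t<a)
    ... | inj₂ (_ , eq)   = subst (_< p a + n) (≡-sym eq) (ℕₚ.<-≤-trans (p<n t) (ℕₚ.m≤n+m n (p a)))

    κ-surj : ∀ {j} → p a ≤ j → j < p a + n → ∃ λ v → κ v ≡ j
    κ-surj {j} a≤j j<a+n with j <? n
    ... | yes j<n with p-surj j<n
    ...   | v , refl = v , κ-unwrapped a≤j
    κ-surj {j} a≤j j<a+n | no ¬j<n with p-surj {j ∸ n} (ℕₚ.<-trans j-n<a (p<n a))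
      where
      j-n<a : j ∸ n < p a
      j-n<a = ℕₚ.+-cancelʳ-< n _ _ (subst (_< p a + n) (≡-sym (ℕₚ.m∸n+n≡m (ℕₚ.≮⇒≥ ¬j<n))) j<a+n)
    ...   | v , eq = v , trans
      (κ-wrapped (subst (_< p a) (≡-sym eq) (ℕₚ.+-cancelʳ-< n _ _
        (subst (_< p a + n) (≡-sym (ℕₚ.m∸n+n≡m (ℕₚ.≮⇒≥ ¬j<n))) j<a+n))))
      (trans (cong (_+ n) eq) (ℕₚ.m∸n+n≡m (ℕₚ.≮⇒≥ ¬j<n)))

    h : Fin 3 → Fin n
    h 0F = a
    h 1F = b
    h 2F = c

    h-inj : ∀ {k l} → h k ≡ h l → k ≡ l
    h-inj {0F} {0F} _  = refl
    h-inj {0F} {1F} eq = contradiction (cong p eq) (ℕₚ.<⇒≢ a<b)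
    h-inj {0F} {2F} eq = contradiction (cong p eq) (ℕₚ.<⇒≢ a<c)
    h-inj {1F} {0F} eq = contradiction (cong p (≡-sym eq)) (ℕₚ.<⇒≢ a<b)
    h-inj {1F} {1F} _  = refl
    h-inj {1F} {2F} eq = contradiction (cong p eq) (ℕₚ.<⇒≢ b<c)
    h-inj {2F} {0F} eq = contradiction (cong p (≡-sym eq)) (ℕₚ.<⇒≢ a<c)
    h-inj {2F} {1F} eq = contradiction (cong p (≡-sym eq)) (ℕₚ.<⇒≢ b<c)
    h-inj {2F} {2F} _  = refl

    arc : Fin n → Fin 3
    arc t with κ t <? p b | κ t <? p c
    ... | yes _ | _     = 0F
    ... | no _  | yes _ = 1F
    ... | no _  | no _  = 2F

    -- The position is kept both in terms of `p`, as the chords are stated, and of `κ`, for which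
    -- each arc is an interval.
    data Region (t : Fin n) : Fin 3 → Set where
      in-ab : Inside a b t → κ a < κ t → κ t < κ b → Region t 0F
      in-bc : Inside b c t → κ b < κ t → κ t < κ c → Region t 1F
      in-ca : Outside a c t → κ c < κ t → Region t 2F

    inside-κ : ∀ {t q} → q < n → κ t < q → p t ≡ κ t
    inside-κ {t} q<n lt with κ-cases t
    ... | inj₁ (_ , eq) = contradiction (subst (_< _) eq lt)
      (ℕₚ.≤⇒≯ (ℕₚ.≤-trans (ℕₚ.<⇒≤ q<n) (ℕₚ.m≤n+m n (p t))))
    ... | inj₂ (_ , eq) = ≡-sym eq

    region-ab : ∀ {t} → κ a < κ t → κ t < κ b → Region t 0F
    region-ab {t} a<t t<b = in-ab
      (subst₂ _<_ κa (≡-sym eq) a<t , subst₂ _<_ (≡-sym eq) κb t<b) a<t t<b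
      where eq = inside-κ (p<n b) (subst (κ t <_) κb t<b)

    region-bc : ∀ {t} → κ b < κ t → κ t < κ c → Region t 1F
    region-bc {t} b<t t<c = in-bc
      (subst₂ _<_ κb (≡-sym eq) b<t , subst₂ _<_ (≡-sym eq) κc t<c) b<t t<c
      where eq = inside-κ (p<n c) (subst (κ t <_) κc t<c)

    region-ca : ∀ {t} → κ c < κ t → Region t 2F
    region-ca {t} c<t with κ-cases t
    ... | inj₁ (t<a , _) = in-ca (inj₁ t<a) c<t
    ... | inj₂ (_ , eq)  = in-ca (inj₂ (subst₂ _<_ κc eq c<t)) c<t

    region : ∀ {t} → (∀ k → t ≢ h k) → Region t (arc t)
    region {t} nt with κ t <? p b | κ t <? p c
    ... | yes t<b | _ = region-ab
      (ℕₚ.≤∧≢⇒< (subst (_≤ κ t) (≡-sym κa) (a≤κ t)) (λ eq → nt 0F (κ-inj (≡-sym eq))))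
      (subst (κ t <_) (≡-sym κb) t<b)
    ... | no t≮b | yes t<c = region-bc
      (ℕₚ.≤∧≢⇒< (subst (_≤ κ t) (≡-sym κb) (ℕₚ.≮⇒≥ t≮b)) (λ eq → nt 1F (κ-inj (≡-sym eq))))
      (subst (κ t <_) (≡-sym κc) t<c)
    ... | no _ | no t≮c = region-ca
      (ℕₚ.≤∧≢⇒< (subst (_≤ κ t) (≡-sym κc) (ℕₚ.≮⇒≥ t≮c)) (λ eq → nt 2F (κ-inj (≡-sym eq))))

    -- An edge between different arcs would cross a chord between two hubs.
    regions-joined : ∀ {u v i j} → Region u i → Region v j → Adj G u v → i ≡ j
    regions-joined (in-ab _ _ _) (in-ab _ _ _) _ = refl
    regions-joined (in-bc _ _ _) (in-bc _ _ _) _ = refl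
    regions-joined (in-ca _ _)   (in-ca _ _)   _ = refl
    regions-joined (in-ab u _ _) (in-bc v _ _) uv = contradiction uv (chord-ab u (inj₂ (proj₁ v)))
    regions-joined (in-bc u _ _) (in-ab v _ _) uv =
      contradiction (Adj-sym G uv) (chord-ab v (inj₂ (proj₁ u)))
    regions-joined (in-ab (a<u , u<b) _ _) (in-ca v _) uv =
      contradiction uv (chord-ac (a<u , ℕₚ.<-trans u<b b<c) v)
    regions-joined (in-ca u _) (in-ab (a<v , v<b) _ _) uv =
      contradiction (Adj-sym G uv) (chord-ac (a<v , ℕₚ.<-trans v<b b<c) u)
    regions-joined (in-bc (b<u , u<c) _ _) (in-ca v _) uv =
      contradiction uv (chord-ac (ℕₚ.<-trans a<b b<u , u<c) v)
    regions-joined (in-ca u _) (in-bc (b<v , v<c) _ _) uv =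
      contradiction (Adj-sym G uv) (chord-ac (ℕₚ.<-trans a<b b<v , v<c) u)

    -- `w` would be dominated by an end of the arc, and that edge would cross `uv`.
    no-vertex-between : ∀ {u v w i} → Region u i → Region v i → Adj G u v →
                        κ u < κ w → ¬ κ w < κ v
    no-vertex-between (in-ab _ a<u _) (in-ab _ _ v<b) uv u<w w<v
      with region-ab (ℕₚ.<-trans a<u u<w) (ℕₚ.<-trans w<v v<b)
    ... | in-ab w-in _ _ with dom-ab w-in
    ...   | inj₁ aw = κ-nc aw uv a<u u<w w<v
    ...   | inj₂ bw = κ-nc uv (Adj-sym G bw) u<w w<v v<b
    no-vertex-between (in-bc _ b<u _) (in-bc _ _ v<c) uv u<w w<v
      with region-bc (ℕₚ.<-trans b<u u<w) (ℕₚ.<-trans w<v v<c)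
    ... | in-bc w-in _ _ with dom-bc w-in
    ...   | inj₁ bw = κ-nc bw uv b<u u<w w<v
    ...   | inj₂ cw = κ-nc uv (Adj-sym G cw) u<w w<v v<c
    no-vertex-between (in-ca _ c<u) (in-ca _ _) uv u<w w<v
      with region-ca (ℕₚ.<-trans c<u u<w)
    ... | in-ca w-out _ with dom-ac w-out
    ...   | inj₁ aw = κ-nc aw uv (ℕₚ.<-trans (subst₂ _<_ (≡-sym κa) (≡-sym κc) a<c) c<u) u<w w<v
    ...   | inj₂ cw = κ-nc cw uv c<u u<w w<v

    consecutive : ∀ {u v i} → Region u i → Region v i → Adj G u v → κ u < κ v →
                  κ v ≡ suc (κ u)
    consecutive {u} {v} ru rv uv u<v with ℕₚ.m≤n⇒m<n∨m≡n u<v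
    ... | inj₂ eq = ≡-sym eq
    ... | inj₁ lt with κ-surj (ℕₚ.≤-trans (a≤κ u) (ℕₚ.n≤1+n _)) (ℕₚ.<-trans lt (κ<a+n v))
    ...   | w , eq = contradiction (subst (_< κ v) (≡-sym eq) lt)
      (no-vertex-between ru rv uv (subst (κ u <_) (≡-sym eq) (ℕₚ.n<1+n _)))

    -- The third hub lies across the chord that joins the two ends of an arc.
    hub-reach : ∀ k {v i} → Region v i → Adj G (h k) v → i ≡ k ⊎ i ≡ prev k
    hub-reach 0F (in-ab _ _ _) _ = inj₁ refl
    hub-reach 0F (in-bc v _ _) e = contradiction (Adj-sym G e) (chord-bc v (inj₁ a<b))
    hub-reach 0F (in-ca _ _)   _ = inj₂ refl
    hub-reach 1F (in-ab _ _ _) _ = inj₂ refl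
    hub-reach 1F (in-bc _ _ _) _ = inj₁ refl
    hub-reach 1F (in-ca v _)   e = contradiction e (chord-ac (a<b , b<c) v)
    hub-reach 2F (in-ab v _ _) e = contradiction (Adj-sym G e) (chord-ab v (inj₂ b<c))
    hub-reach 2F (in-bc _ _ _) _ = inj₂ refl
    hub-reach 2F (in-ca _ _)   _ = inj₁ refl

    -- In the opposite order the two hub edges would cross.
    fans-ordered : ∀ k {u v} → Region u k → Region v k → Adj G (h k) u → Adj G (h (next k)) v →
                   κ u ≤ κ v
    fans-ordered 0F (in-ab _ _ u<b) (in-ab _ a<v _) au bv =
      ℕₚ.≮⇒≥ λ v<u → κ-nc au (Adj-sym G bv) a<v v<u u<b
    fans-ordered 1F (in-bc _ _ u<c) (in-bc _ b<v _) bu cv =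
      ℕₚ.≮⇒≥ λ v<u → κ-nc bu (Adj-sym G cv) b<v v<u u<c
    fans-ordered 2F (in-ca _ _) (in-ca _ c<v) cu av =
      ℕₚ.≮⇒≥ λ v<u → κ-nc av cu (subst₂ _<_ (≡-sym κa) (≡-sym κc) a<c) c<v v<u

    frame : Frame G
    frame = record
      { h = h ; h-inj = h-inj ; arc = arc ; κ = κ ; κ-inj = κ-inj
      ; rim-arc = λ nu nv → regions-joined (region nu) (region nv)
      ; rim-κ = λ {u} {v} nu nv uv → rim-κ nu nv uv
      ; spoke-arc = λ {k} nv → hub-reach k (region nv)
      ; arc-order = λ {k} nu nv au av →
          fans-ordered k (subst (Region _) au (region nu)) (subst (Region _) av (region nv))
      }
      where
      rim-κ : ∀ {u v} → (∀ k → u ≢ h k) → (∀ k → v ≢ h k) → Adj G u v →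
              κ v ≡ suc (κ u) ⊎ κ u ≡ suc (κ v)
      rim-κ {u} {v} nu nv uv = go (subst (Region u) (regions-joined (region nu) (region nv) uv) (region nu))
                                  (region nv)
        where
        go : ∀ {i} → Region u i → Region v i → κ v ≡ suc (κ u) ⊎ κ u ≡ suc (κ v)
        go ru rv with ℕₚ.<-cmp (κ u) (κ v)
        ... | tri< u<v _ _ = inj₁ (consecutive ru rv uv u<v)
        ... | tri≈ _ eq _  = contradiction (κ-inj eq) (Adj-irrefl G uv)
        ... | tri> _ _ v<u = inj₂ (consecutive rv ru (Adj-sym G uv) v<u)

    hubs-adjacent : (∀ {u v} → p u < p v → Chord u v → Adj G u v) →
                    ∀ {k l} → k ≢ l → Adj G (h k) (h l)
    hubs-adjacent joined {0F} {0F} k≢l = contradiction refl k≢l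
    hubs-adjacent joined {0F} {1F} _ = joined a<b chord-ab
    hubs-adjacent joined {0F} {2F} _ = joined a<c chord-ac
    hubs-adjacent joined {1F} {0F} _ = Adj-sym G (joined a<b chord-ab)
    hubs-adjacent joined {1F} {1F} k≢l = contradiction refl k≢l
    hubs-adjacent joined {1F} {2F} _ = joined b<c chord-bc
    hubs-adjacent joined {2F} {0F} _ = Adj-sym G (joined a<c chord-ac)
    hubs-adjacent joined {2F} {1F} _ = Adj-sym G (joined b<c chord-bc)
    hubs-adjacent joined {2F} {2F} k≢l = contradiction refl k≢l

-- The upper bounds

module SpokeCount {n} {G : Graph n} (F : Frame G) where
  open Frame F
  open Colouring F

  spokes-count : ∀ k {ys} → Unique ys → All (λ y → Adj G (h k) y × ¬ Spoke k y) ys →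
                 length ys + length (spokes k) ≤ Δ G
  spokes-count k {ys} ys! ys-ok = subst (_≤ Δ G) (Listₚ.length-++ ys)
    (ℕₚ.≤-trans (deg-≥ G (h k) unique (adjacent ∘ ∈-++⁻ ys)) (deg≤Δ G (h k)))
    where
    spoke : ∀ {y} → y ∈ spokes k → Spoke k y
    spoke = proj₂ ∘ ∈-filter⁻ (Spoke? k) {xs = allFin n}
    unique : Unique (ys ++ spokes k)
    unique = Uniqueₚ.++⁺ ys! (Uniqueₚ.filter⁺ (Spoke? k) (Uniqueₚ.allFin⁺ n))
      λ (y∈ , y∈′) → proj₂ (All.lookup ys-ok y∈) (spoke y∈′)
    adjacent : ∀ {y} → y ∈ ys ⊎ y ∈ spokes k → Adj G (h k) y
    adjacent (inj₁ y∈) = proj₁ (All.lookup ys-ok y∈)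
    adjacent (inj₂ y∈) = proj₁ (proj₂ (spoke y∈))

  special-not-spoke : ∀ {k v} → Special k v → Adj G (h (next k)) v × ¬ Spoke (next k) v
  special-not-spoke (_ , kv , k′v) = k′v , λ sv → spoke-next sv kv

  colouring-Δ+6 : StarEdgeColouring G (Δ G + 6)
  colouring-Δ+6 = subst (StarEdgeColouring G) (ℕₚ.+-comm 6 (Δ G)) (frameColouring
    (λ k → spokes-count k [] [])
    -- The special vertex is a neighbour of `h (next k)` but not a spoke of it, so a number below
    -- `Δ G` stays free there.
    (λ {k} _ sv → spokes-count (next k) ([] ∷ []) (special-not-spoke sv ∷ [])))

  module _ (hubs-adjacent : ∀ {k l} → k ≢ l → Adj G (h k) (h l)) where

    hub-not-spoke : ∀ {k l} → k ≢ l → Adj G (h k) (h l) × ¬ Spoke k (h l)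
    hub-not-spoke {k} {l} k≢l = hubs-adjacent k≢l , λ (nh , _) → nh l refl

    spokes+2≤Δ : ∀ k → 2 + length (spokes k) ≤ Δ G
    spokes+2≤Δ k = spokes-count k
      (((λ eq → prev≢next k (≡-sym (h-inj eq))) ∷ []) ∷ [] ∷ [])
      (hub-not-spoke (next≢ k ∘ ≡-sym) ∷ hub-not-spoke (prev≢ k ∘ ≡-sym) ∷ [])

    -- The special vertex and the two other hubs are neighbours of `h (next k)` that are not its
    -- spokes.
    spokes+3≤Δ : ∀ {k v} → Special k v → 3 + length (spokes (next k)) ≤ Δ G
    spokes+3≤Δ {k} {v} sv@(nv , _) = spokes-count (next k)
      ((nv _ ∷ nv _ ∷ []) ∷
       ((λ eq → prev≢next (next k) (≡-sym (h-inj eq))) ∷ []) ∷ [] ∷ [])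
      (special-not-spoke sv ∷ hub-not-spoke (next≢ (next k) ∘ ≡-sym) ∷
       hub-not-spoke (prev≢ (next k) ∘ ≡-sym) ∷ [])

    colouring-Δ+4 : StarEdgeColouring G (Δ G + 4)
    colouring-Δ+4 = subst (StarEdgeColouring G) 6+[Δ-2]≡Δ+4 (frameColouring
      (λ k → ℕₚ.∸-monoˡ-≤ 2 (spokes+2≤Δ k))
      (λ _ sv → ℕₚ.∸-monoˡ-≤ 2 (spokes+3≤Δ sv)))
      where
      6+[Δ-2]≡Δ+4 : 6 + (Δ G ∸ 2) ≡ Δ G + 4
      6+[Δ-2]≡Δ+4 = trans (cong (4 +_)
        (ℕₚ.m+[n∸m]≡n (ℕₚ.≤-trans (ℕₚ.m≤m+n 2 _) (spokes+2≤Δ 0F)))) (ℕₚ.+-comm 4 (Δ G))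

-- Hubs of an outerplanar graph of diameter 3

module OuterplanarHubs {n} {G : Graph n} (n>2 : 2 < n) (outer : Outerplanar G)
                       (diam : Diameter G 3) where

  pos = proj₁ outer
  pos-inj = proj₁ (proj₂ outer)
  nc = proj₂ (proj₂ outer)

  p : Fin n → ℕ
  p = toℕ ∘ pos

  p-surj : ∀ {i} → i < n → ∃ λ v → p v ≡ i
  p-surj i<n with injective⇒surjective pos pos-inj (fromℕ< i<n)
  ... | v , eq = v , trans (cong toℕ eq) (Finₚ.toℕ-fromℕ< i<n)

  open Chords {G = G} p (pos-inj _ _ ∘ Finₚ.toℕ-injective) (Finₚ.toℕ<n ∘ pos) p-surj
    (λ uv wx u<w w<v v<x → nc _ _ _ _ uv wx (u<w , w<v , v<x)) public

  theHubs : Hubs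
  theHubs = hubs (λ u v → let e , (walk , _) , e≤3 = proj₁ diam u v in e , walk , e≤3) n>2

  theFrame : Frame G
  theFrame = frame theHubs

  -- An edge crossing the new one would join the two sides of the chord. The reversed copy `vu`
  -- never takes part, since a crossing lists each edge from its earlier to its later end.
  chord-addable : ∀ {u v} → p u < p v → Chord u v → OuterplanarAdj (addEdgeAdj (adj G) u v)
  chord-addable {u} {v} u<v chord = pos , pos-inj , λ x y z w xy zw → crossing (edge xy) (edge zw)
    where
    data Edge (x y : Fin n) : Set where
      old : Adj G x y → Edge x y
      uv  : x ≡ u → y ≡ v → Edge x y
      vu  : x ≡ v → y ≡ u → Edge x y
    edge : ∀ {x y} → T (addEdgeAdj (adj G) u v x y) → Edge x y
    edge {x} {y} t with Equivalence.to (T-∨ {adj G x y}) t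
    ... | inj₁ xy = old xy
    ... | inj₂ new with Equivalence.to (T-∨ {⌊ x ≟ᶠ u ⌋ ∧ ⌊ y ≟ᶠ v ⌋}) new
    ...   | inj₁ both = let x≡u , y≡v = Equivalence.to (T-∧ {⌊ x ≟ᶠ u ⌋}) both in
      uv (toWitness {a? = x ≟ᶠ u} x≡u) (toWitness {a? = y ≟ᶠ v} y≡v)
    ...   | inj₂ both = let x≡v , y≡u = Equivalence.to (T-∧ {⌊ x ≟ᶠ v ⌋}) both in
      vu (toWitness {a? = x ≟ᶠ v} x≡v) (toWitness {a? = y ≟ᶠ u} y≡u)
    crossing : ∀ {x y z w} → Edge x y → Edge z w → ¬ (p x < p z × p z < p y × p y < p w)
    crossing (old xy) (old zw) = nc _ _ _ _ xy zw
    crossing (uv refl refl) (old zw) (u<z , z<v , v<w) = chord (u<z , z<v) (inj₂ v<w) zw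
    crossing (old xy) (uv refl refl) (x<u , u<y , y<v) =
      chord (u<y , y<v) (inj₁ x<u) (Adj-sym G xy)
    crossing (uv refl refl) (uv refl refl) (u<u , _) = ℕₚ.<-irrefl refl u<u
    crossing (uv refl refl) (vu refl refl) (_ , v<v , _) = ℕₚ.<-irrefl refl v<v
    crossing (vu refl refl) _ (v<z , z<u , _) = ℕₚ.<-asym u<v (ℕₚ.<-trans v<z z<u)
    crossing _ (vu refl refl) (_ , v<y , y<u) = ℕₚ.<-asym u<v (ℕₚ.<-trans v<y y<u)

theorem3p5 : (∀ (n : ℕ) → 1 ≤ n → (G : Graph n) →
    TwoConnected G → Outerplanar G → Diameter G 3 →
    ∃ λ χ → IsStarChromaticIndex G χ × Δ G ≤ χ × χ ≤ Δ G + 6)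
    ×
    (∀ (n : ℕ) → 1 ≤ n → (G : Graph n) →
    TwoConnected G → MaximalOuterplanar G → Diameter G 3 →
    ∃ λ χ → IsStarChromaticIndex G χ × Δ G ≤ χ × χ ≤ Δ G + 4)
theorem3p5 = part₁ , part₂
  where
  part₁ = λ n _ G (n>2 , _) outer diam →
    let open OuterplanarHubs {G = G} n>2 outer diam
    in starChromaticIndex G (SpokeCount.colouring-Δ+6 theFrame)
  part₂ = λ n _ G (n>2 , _) (outer , maximal) diam →
    let open OuterplanarHubs {G = G} n>2 outer diam
        joined : ∀ {u v} → p u < p v → Chord u v → Adj G u v
        -- A missing chord could be added by `chord-addable`, against maximality.
        joined {u} {v} u<v chord = decidable-stable (Adj? G u v) λ ¬uv →
          maximal u v (λ u≡v → ℕₚ.<⇒≢ u<v (cong p u≡v)) ¬uv (chord-addable u<v chord)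
    in starChromaticIndex G
         (SpokeCount.colouring-Δ+4 theFrame (hubs-adjacent theHubs joined))
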